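{- Let $G$ be a simple graph on vertex set $\{1,\ldots,n\}$ and $k\ge 1$ an integer such that $G$ has a non-empty $k$-core, and let $V_{k\text{ -core}}$ denote the vertex set of the $k$-core of $G$. Let $\mathbf{x}^{(k)}=(x^{(k)}_1,\ldots,x^{(k)}_n)^{\mathrm T}$ be a Perron eigenvector of $\mathcal{A}^{(k)}(G)$, i.e. a nonzero entrywise nonnegative eigenvector of $\mathcal{A}^{(k)}(G)$ corresponding to the eigenvalue $\rho_k(G)$. Then $\operatorname{supp}(\mathbf{x}^{(k)})\subseteq V_{k\text{ -core}}$. Moreover, if the subgraph of $G$ induced by $V_{k\text{ -core}}$ is connected, then $\operatorname{supp}(\mathbf{x}^{(k)})=V_{k\text{ -core}}$.
   Context: All graphs are finite, simple and undirected. The $k$-core of a graph $G$ is the maximal subgraph of $G$ in which every vertex has degree at least $k$ within the subgraph. For a tensor $\mathcal{A}=(a_{i_1 i_2\cdots i_m})$ of order $m$ and dimension $n$ and $\mathbf{x}\in\mathbb{C}^n$, $\mathcal{A}\mathbf{x}^{m-1}\in\mathbb{C}^n$ has $i$-th component $\sum_{i_2,\ldots,i_m=1}^n a_{i i_2\cdots i_m}x_{i_2}\cdots x_{i_m}$. A complex number $\lambda$ is an eigenvalue of $\mathcal{A}$ if there is a nonzero $\mathbf{x}\in\mathbb{C}^n$ with $\mathcal{A}\mathbf{x}^{m-1}=\lambda\mathbf{x}^{[m-1]}$, where $\mathbf{x}^{[m-1]}=(x_1^{m-1},\ldots,x_n^{m-1})^{\mathrm T}$; $\mathbf{x}$ is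 then an eigenvector. The spectral radius $\rho(\mathcal{A})$ is the largest modulus of the eigenvalues of $\mathcal{A}$. For a graph $G$ on vertex set $\{1,\ldots,n\}$ with neighborhoods $N_G(i)$, the $k$-adjacency tensor $\mathcal{A}^{(k)}(G)=(a_{i_1 i_2\cdots i_{k+1}})$ is the order-$(k+1)$, dimension-$n$ tensor with $a_{i_1 i_2\cdots i_{k+1}}=1/k!$ if $i_1,\ldots,i_{k+1}$ are pairwise distinct and $\{i_2,\ldots,i_{k+1}\}\subseteq N_G(i_1)$, and $0$ otherwise. Equivalently, $(\mathcal{A}^{(k)}(G)\mathbf{x}^k)_i=\sum_{T\subseteq N_G(i),\,|T|=k}\prod_{j\in T}x_j$. Define $\rho_k(G)=\rho(\mathcal{A}^{(k)}(G))$. The support of $\mathbf{x}$ is $\operatorname{supp}(\mathbf{x})=\{i: x_i\neq 0\}$. -}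

module Defs where

open import Algebra.Bundles using (RawMonoid; RawRing)
open import Algebra.Core using (Op₁; Op₂)
import Algebra.Definitions.RawMonoid as RawMonoidDefs
import Algebra.Definitions.RawSemiring as RawSemiringDefs
open import Algebra.Structures using (IsCommutativeRing)
open import Data.Bool.Base using (if_then_else_)
open import Data.Fin.Base using (Fin)
open import Data.Fin.Properties using (_≟_)
open import Data.Fin.Subset using (Subset; _∈_; _⊆_; ∣_∣)
open import Data.Fin.Subset.Properties using (_∈?_)
open import Data.Nat.Base as ℕ using (ℕ; zero; suc)
open import Data.Product.Base using (_×_; _,_; ∃-syntax; proj₁; proj₂)
open import Data.Product.Relation.Binary.Pointwise.NonDependent using (Pointwise)
import Data.Vec.Base as Vec
open import Data.Vec.Base using (Vec; _∷_)
open import Data.Vec.Functional using (Vector)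
open import Data.Vec.Relation.Unary.All using (All; all?)
open import Data.Vec.Relation.Unary.AllPairs using (allPairs?)
open import Data.Vec.Relation.Unary.Unique.Propositional using (Unique)
open import Level using (Level; _⊔_; 0ℓ) renaming (suc to lsuc)
open import Relation.Binary.Core using (Rel)
open import Relation.Binary.Construct.Closure.ReflexiveTransitive using (Star)
open import Relation.Binary.Definitions using (Decidable; Symmetric)
open import Relation.Binary.Structures using (IsDecTotalOrder)
open import Relation.Nullary.Decidable using (Dec; does; ¬?; _×-dec_)
open import Relation.Nullary.Negation using (¬_)
open import Relation.Unary using (Pred; Satisfiable)

-- The standard library has no real numbers.  They are axiomatised here, up to
-- isomorphism, as a Dedekind-complete ordered field in the classical sense
-- (comparisons are decidable, and every inhabited bounded predicate has a
-- supremum), and results are proved for an arbitrary model.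
record RealField c ℓ₁ ℓ₂ : Set (lsuc (c ⊔ ℓ₁ ⊔ ℓ₂)) where
  infix  8 _⁻¹ -_
  infixl 7 _*_
  infixl 6 _+_
  infix  4 _≈_ _≤_
  field
    Carrier : Set c
    _≈_     : Rel Carrier ℓ₁
    _≤_     : Rel Carrier ℓ₂
    _+_ _*_ : Op₂ Carrier
    -_ _⁻¹  : Op₁ Carrier
    0# 1#   : Carrier

    isCommutativeRing : IsCommutativeRing _≈_ _+_ _*_ -_ 0# 1#
    isDecTotalOrder   : IsDecTotalOrder _≈_ _≤_

    0≉1       : ¬ 0# ≈ 1#
    -- The value of 0# ⁻¹ is unspecified.
    ⁻¹-inverse : ∀ x → ¬ x ≈ 0# → x * x ⁻¹ ≈ 1#

    +-monoʳ-≤  : ∀ x {y z} → y ≤ z → x + y ≤ x + z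
    *-nonNeg   : ∀ {x y} → 0# ≤ x → 0# ≤ y → 0# ≤ x * y

  UpperBound : ∀ {p} → Pred Carrier p → Pred Carrier (c ⊔ ℓ₂ ⊔ p)
  UpperBound S b = ∀ x → S x → x ≤ b

  field
    supremum : (S : Pred Carrier (c ⊔ ℓ₁ ⊔ ℓ₂)) →
               Satisfiable S → Satisfiable (UpperBound S) →
               ∃[ s ] UpperBound S s × (∀ b → UpperBound S b → s ≤ b)

record Graph (n : ℕ) : Set₁ where
  field
    Adj    : Rel (Fin n) 0ℓ
    adj?   : Decidable Adj
    sym    : Symmetric Adj
    irrefl : ∀ {i} → ¬ Adj i i

record Subgraph {n} (G : Graph n) : Set₁ where
  open Graph G using (Adj)
  field
    verts    : Subset n
    Edge     : Rel (Fin n) 0ℓ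
    edge?    : Decidable Edge
    edge-sym : Symmetric Edge
    edge⇒adj : ∀ {i j} → Edge i j → Adj i j
    edge⇒∈   : ∀ {i j} → Edge i j → i ∈ verts

  degree : Fin n → ℕ
  degree i = ∣ Vec.tabulate (λ j → does (edge? i j)) ∣

  Connected : Set
  Connected = ∀ {i j} → i ∈ verts → j ∈ verts → Star Edge i j

module _ {n} {G : Graph n} where
  open Subgraph

  infix 4 _⊑_

  _⊑_ : Rel (Subgraph G) 0ℓ
  H ⊑ K = verts H ⊆ verts K × (∀ {i j} → Edge H i j → Edge K i j)

  MinDegree≥ : ℕ → Subgraph G → Set
  MinDegree≥ k H = ∀ {i} → i ∈ verts H → k ℕ.≤ degree H i

  IsCore : ℕ → Subgraph G → Set₁
  IsCore k C = MinDegree≥ k C × (∀ H → MinDegree≥ k H → C ⊑ H → H ⊑ C)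

infix 9 _[_]

_[_] : ∀ {n} (G : Graph n) → Subset n → Subgraph G
G [ V ] = record
  { verts    = V
  ; Edge     = λ i j → (i ∈ V × j ∈ V) × Adj i j
  ; edge?    = λ i j → ((i ∈? V) ×-dec (j ∈? V)) ×-dec adj? i j
  ; edge-sym = λ ((i∈V , j∈V) , i~j) → (j∈V , i∈V) , sym i~j
  ; edge⇒adj = proj₂
  ; edge⇒∈   = λ e → proj₁ (proj₁ e)
  }
  where open Graph G

module Tensors {c ℓ₁ ℓ₂} (R : RealField c ℓ₁ ℓ₂) where
  private module R = RealField R

  ℝ : Set c
  ℝ = R.Carrier

  private
    +-rawMonoid : RawMonoid c ℓ₁
    +-rawMonoid = record { _≈_ = R._≈_ ; _∙_ = R._+_ ; ε = R.0# }

  open RawMonoidDefs +-rawMonoid using () renaming (_×_ to infixr 8 _×ℝ_)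

  -- Complex numbers as pairs (real part , imaginary part).
  complexRawRing : RawRing c ℓ₁
  complexRawRing = record
    { Carrier = ℝ × ℝ
    ; _≈_     = Pointwise R._≈_ R._≈_
    ; _+_     = λ (a , b) (a′ , b′) → a R.+ a′ , b R.+ b′
    ; _*_     = λ (a , b) (a′ , b′) →
                  a R.* a′ R.+ R.- (b R.* b′) , a R.* b′ R.+ b R.* a′
    ; -_      = λ (a , b) → R.- a , R.- b
    ; 0#      = R.0# , R.0#
    ; 1#      = R.1# , R.0#
    }

  open RawRing complexRawRing public
    using (_≈_; _≉_; _+_; _*_; 0#; 1#; rawSemiring)
    renaming (Carrier to ℂ)
  open RawSemiringDefs rawSemiring public using (sum; product; _^_)

  real : ℝ → ℂ
  real a = a , R.0#

  NonNegative : ℂ → Set (ℓ₁ ⊔ ℓ₂)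
  NonNegative (a , b) = R.0# R.≤ a × b R.≈ R.0#

  -- IsModulus z r  means  r = √(a² + b²)  for  z = a + b i.
  IsModulus : ℂ → ℝ → Set (ℓ₁ ⊔ ℓ₂)
  IsModulus (a , b) r = R.0# R.≤ r × r R.* r R.≈ a R.* a R.+ b R.* b

  Tensor : ℕ → ℕ → Set c
  Tensor m n = Vec (Fin n) m → ℂ

  -- The sum of f (i₁ ∷ ⋯ ∷ iₘ ∷ []) over all i₁, …, iₘ.
  sumIndices : ∀ {m n} → (Vec (Fin n) m → ℂ) → ℂ
  sumIndices {zero}  f = f Vec.[]
  sumIndices {suc m} f = sum λ i → sumIndices λ is → f (i ∷ is)

  monomial : ∀ {m n} → Vector ℂ n → Vec (Fin n) m → ℂ
  monomial x is = product λ p → x (Vec.lookup is p)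

  apply : ∀ {m n} → Tensor (suc m) n → Vector ℂ n → Vector ℂ n
  apply A x i = sumIndices λ is → A (i ∷ is) * monomial x is

  IsEigenpair : ∀ {m n} → Tensor (suc m) n → ℂ → Vector ℂ n → Set ℓ₁
  IsEigenpair {m} A z x =
    ¬ (∀ i → x i ≈ 0#) × (∀ i → apply A x i ≈ z * x i ^ m)

  IsEigenvalue : ∀ {m n} → Tensor (suc m) n → ℂ → Set (c ⊔ ℓ₁)
  IsEigenvalue A z = ∃[ x ] IsEigenpair A z x

  IsSpectralRadius : ∀ {m n} → Tensor (suc m) n → ℝ → Set (c ⊔ ℓ₁ ⊔ ℓ₂)
  IsSpectralRadius A ρ =
    (∃[ z ] IsEigenvalue A z × IsModulus z ρ) ×
    (∀ z r → IsEigenvalue A z → IsModulus z r → r R.≤ ρ)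

  IsPerronEigenvector : ∀ {m n} → Tensor (suc m) n → Vector ℂ n → Set (c ⊔ ℓ₁ ⊔ ℓ₂)
  IsPerronEigenvector A x =
    ∃[ ρ ] IsSpectralRadius A ρ × IsEigenpair A (real ρ) x × (∀ i → NonNegative (x i))

  adjacencyTensor : ∀ {n} (k : ℕ) → Graph n → Tensor (suc k) n
  adjacencyTensor k G (i ∷ is) =
    if does (distinct? ×-dec neighbours?)
    then real (((k ℕ.!) ×ℝ R.1#) R.⁻¹)
    else 0#
    where
    open Graph G

    distinct? : Dec (Unique (i ∷ is))
    distinct? = allPairs? (λ j l → ¬? (j ≟ l)) (i ∷ is)

    neighbours? : Dec (All (Adj i) is)
    neighbours? = all? (adj? i) is

  supp : ∀ {n} → Vector ℂ n → Pred (Fin n) ℓ₁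
  supp x i = x i ≉ 0#

-- Call U ⊆ V a component of the core if U is connected, its vertices have at
-- least k neighbours in U and all other vertices have fewer.  Let μ be the
-- infimum of the λ′ for which some y > 0 on U satisfies A y ≤ λ′ y^[k] on U
-- (Collatz–Wielandt).  Connectedness bounds the normalised such y, so their
-- lower limit as λ′ decreases to μ exists, and by monotonicity and homogeneity
-- it attains μ.  If the inequality were strict at one vertex, lowering y there
-- would make it strict at the neighbours, hence everywhere, against minimality:
-- so A y = μ y^[k], and y extended by zero is an eigenvector of A.  Thus
-- 0 < μ ≤ ρ.  Since ρ > 0, each vertex of supp x has k neighbours in supp x, so
-- supp x ⊆ V by maximality of the core.  If V is connected, take U = V and
-- t = max x/y: from A x = ρ x^[k] and A (t y) = μ (t y)^[k] ≤ ρ (t y)^[k] the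
-- vertices with x = t y are closed under adjacency, so x = t y > 0 on V.
--
-- Both conclusions are stable under double negation, so the argument is
-- carried out classically in the double-negation monad.
module Submission where

open import Algebra.Bundles using (CommutativeRing; Semiring)
import Algebra.Definitions.RawMonoid as RawMonoidDefs
import Algebra.Definitions.RawSemiring as RawSemiringDefs
import Algebra.Properties.CommutativeSemigroup as CommutativeSemigroupProperties
import Algebra.Properties.CommutativeSemiring.Exp as CommutativeExp
import Algebra.Properties.Ring as RingProperties
import Algebra.Properties.Semiring.Exp as Exp
open import Data.Bool.Base using (Bool; true; false; if_then_else_)
open import Data.Fin.Base using (Fin; zero; suc)
import Data.Fin.Properties as Fin
open import Data.Fin.Subset
  using (Subset; Nonempty; _∈_; _∉_; _∩_; _∪_; _-_; inside; outside; ⁅_⁆; ∣_∣)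
  renaming (_⊆_ to _⊆ˢ_)
open import Data.Fin.Subset.Properties
  using (_∈?_; nonempty?; Empty-unique; ∣⊥∣≡0; x∈⁅x⁆; x∈⁅y⁆⇒x≡y; p⊆q⇒∣p∣≤∣q∣; ∣p∣≤∣x∷p∣; drop-there;
         p─q⊆p; x∈p∩q⁺; x∈p∩q⁻; x∈p∪q⁻; p⊆p∪q; q⊆p∪q; x∈p⇒∣p-x∣<∣p∣; x∈p∧x≢y⇒x∈p-y)
open import Data.Nat.Base as ℕ using (ℕ; zero; suc; z≤n; s≤s)
import Data.Nat.Properties as ℕ
open import Data.Product.Base using (_×_; _,_; ∃; ∃-syntax; proj₁; proj₂)
open import Data.Sum.Base using (inj₁; inj₂; [_,_]′)
open import Data.Vec.Base as Vec using (Vec; []; _∷_; here; there)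
open import Data.Vec.Functional using (Vector; updateAt)
open import Data.Vec.Functional.Properties using (updateAt-updates; updateAt-minimal)
open import Data.Vec.Properties using (lookup∘tabulate; lookup⇒[]=; []=⇒lookup)
open import Data.Vec.Relation.Unary.All as All using (All; []; _∷_; all?)
open import Data.Vec.Relation.Unary.AllPairs using (allPairs?)
open import Data.Vec.Relation.Unary.Unique.Propositional using (Unique; []; _∷_)
open import Effect.Monad using (RawMonad)
open import Function.Base using (_∘_; id)
open import Level using (_⊔_; 0ℓ) renaming (suc to lsuc)
open import Relation.Binary.Bundles using (DecTotalOrder)
open import Relation.Binary.Construct.Closure.ReflexiveTransitive using (Star; ε; _◅_; _◅◅_; reverse)
open import Relation.Binary.Core using (Rel)
open import Relation.Binary.Definitions using (Total; Transitive)
import Relation.Binary.Properties.DecTotalOrder as DecTotalOrderProperties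
open import Relation.Binary.PropositionalEquality as ≡ using (_≡_; _≢_)
import Relation.Binary.Reasoning.PartialOrder as PartialOrderReasoning
open import Relation.Nullary.Decidable
  using (Dec; yes; no; does; dec-true; dec-false; decidable-stable; ¬¬-excluded-middle; _×-dec_; ¬?)
open import Relation.Nullary.Negation using (¬_; contradiction; ¬¬-Monad)
open import Relation.Unary using (Pred; Decidable; Satisfiable; _⊆_; _≐_)
open import Defs

-- Arithmetic of ordered fields.

module OrderedField {c ℓ₁ ℓ₂} (R : RealField c ℓ₁ ℓ₂) where
  open RealField R public

  commutativeRing : CommutativeRing c ℓ₁
  commutativeRing = record { isCommutativeRing = isCommutativeRing }

  decTotalOrder : DecTotalOrder c ℓ₁ ℓ₂
  decTotalOrder = record { isDecTotalOrder = isDecTotalOrder }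

  open CommutativeRing commutativeRing public
    hiding (Carrier; _≈_; _+_; _*_; -_; 0#; 1#; isCommutativeRing; zero; _-_)
  open RingProperties ring public using (-1*x≈-x; -‿involutive; -0#≈0#; x[y-z]≈xy-xz)
  open Exp semiring public using (_^_; ^-congˡ; ^-homo-*)
  open CommutativeExp commutativeSemiring public using (^-distrib-*)
  open CommutativeSemigroupProperties *-commutativeSemigroup public
    using (interchange; x∙yz≈y∙xz)
  open DecTotalOrder decTotalOrder public
    using (_≤?_; _≟_; total; ≤-respˡ-≈; ≤-respʳ-≈)
    renaming (refl to ≤-refl; reflexive to ≤-reflexive; trans to ≤-trans; antisym to ≤-antisym)
  open DecTotalOrderProperties decTotalOrder public
    using (_<_; ≰⇒>; ≮⇒≥; <⇒≱; <-trans; <-respˡ-≈; <-respʳ-≈)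
  module ≤-Reasoning = PartialOrderReasoning (DecTotalOrder.poset decTotalOrder)

  <⇒≤ : ∀ {x y} → x < y → x ≤ y
  <⇒≤ = proj₁

  <-≤-trans : ∀ {x y z} → x < y → y ≤ z → x < z
  <-≤-trans {x} {y} {z} x<y y≤z = begin-strict x <⟨ x<y ⟩ y ≤⟨ y≤z ⟩ z ∎
    where open ≤-Reasoning

  ≤-<-trans : ∀ {x y z} → x ≤ y → y < z → x < z
  ≤-<-trans {x} {y} {z} x≤y y<z = begin-strict x ≤⟨ x≤y ⟩ y <⟨ y<z ⟩ z ∎
    where open ≤-Reasoning

  +-mono-≤ : ∀ {x y u v} → x ≤ y → u ≤ v → x + u ≤ y + v
  +-mono-≤ {x} {y} {u} {v} x≤y u≤v = begin
    x + u  ≤⟨ +-monoʳ-≤ x u≤v ⟩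
    x + v  ≈⟨ +-comm x v ⟩
    v + x  ≤⟨ +-monoʳ-≤ v x≤y ⟩
    v + y  ≈⟨ +-comm v y ⟩
    y + v  ∎
    where open ≤-Reasoning

  +-cancelˡ-≤ : ∀ x {y z} → x + y ≤ x + z → y ≤ z
  +-cancelˡ-≤ x {y} {z} x+y≤x+z = begin
    y              ≈⟨ lemma y ⟨
    - x + (x + y)  ≤⟨ +-monoʳ-≤ (- x) x+y≤x+z ⟩
    - x + (x + z)  ≈⟨ lemma z ⟩
    z              ∎
    where
    open ≤-Reasoning
    lemma : ∀ y → - x + (x + y) ≈ y
    lemma y = trans (sym (+-assoc (- x) x y)) (trans (+-congʳ (-‿inverseˡ x)) (+-identityˡ y))

  +-monoʳ-< : ∀ x {y z} → y < z → x + y < x + z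
  +-monoʳ-< x y<z = ≰⇒> (<⇒≱ y<z ∘ +-cancelˡ-≤ x)

  +-mono-<-≤ : ∀ {x y u v} → x < y → u ≤ v → x + u < y + v
  +-mono-<-≤ {x} {y} {u} {v} x<y u≤v = begin-strict
    x + u  ≤⟨ +-monoʳ-≤ x u≤v ⟩
    x + v  ≈⟨ +-comm x v ⟩
    v + x  <⟨ +-monoʳ-< v x<y ⟩
    v + y  ≈⟨ +-comm v y ⟩
    y + v  ∎
    where open ≤-Reasoning

  +-mono-≤-< : ∀ {x y u v} → x ≤ y → u < v → x + u < y + v
  +-mono-≤-< {x} {y} {u} {v} x≤y u<v =
    <-respˡ-≈ (+-comm u x) (<-respʳ-≈ (+-comm v y) (+-mono-<-≤ u<v x≤y))

  *-monoʳ-≤ : ∀ {x y z} → 0# ≤ x → y ≤ z → x * y ≤ x * z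
  *-monoʳ-≤ {x} {y} {z} 0≤x y≤z = +-cancelˡ-≤ (- (x * y)) (begin
    - (x * y) + x * y  ≈⟨ -‿inverseˡ (x * y) ⟩
    0#                 ≤⟨ *-nonNeg 0≤x 0≤z-y ⟩
    x * (z + - y)      ≈⟨ x[y-z]≈xy-xz x z y ⟩
    x * z + - (x * y)  ≈⟨ +-comm (x * z) (- (x * y)) ⟩
    - (x * y) + x * z  ∎)
    where
    open ≤-Reasoning
    0≤z-y : 0# ≤ z + - y
    0≤z-y = begin
      0#       ≈⟨ -‿inverseˡ y ⟨
      - y + y  ≤⟨ +-monoʳ-≤ (- y) y≤z ⟩
      - y + z  ≈⟨ +-comm (- y) z ⟩
      z + - y  ∎

  *-monoˡ-≤ : ∀ {x y z} → 0# ≤ x → y ≤ z → y * x ≤ z * x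
  *-monoˡ-≤ {x} {y} {z} 0≤x y≤z =
    ≤-respˡ-≈ (*-comm x y) (≤-respʳ-≈ (*-comm x z) (*-monoʳ-≤ 0≤x y≤z))

  *-mono-≤ : ∀ {x y u v} → 0# ≤ y → 0# ≤ u → x ≤ y → u ≤ v → x * u ≤ y * v
  *-mono-≤ 0≤y 0≤u x≤y u≤v = ≤-trans (*-monoˡ-≤ 0≤u x≤y) (*-monoʳ-≤ 0≤y u≤v)

  0<1 : 0# < 1#
  0<1 = [ (λ 0≤1 → 0≤1 , 0≉1) , (λ 1≤0 → contradiction (≤-antisym (0≤1 1≤0) 1≤0) 0≉1) ]′ (total 0# 1#)
    where
    open ≤-Reasoning
    0≤-1 : 1# ≤ 0# → 0# ≤ - 1#
    0≤-1 1≤0 = begin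
      0#         ≈⟨ -‿inverseˡ 1# ⟨
      - 1# + 1#  ≤⟨ +-monoʳ-≤ (- 1#) 1≤0 ⟩
      - 1# + 0#  ≈⟨ +-identityʳ (- 1#) ⟩
      - 1#       ∎
    0≤1 : 1# ≤ 0# → 0# ≤ 1#
    0≤1 1≤0 = begin
      0#           ≤⟨ *-nonNeg (0≤-1 1≤0) (0≤-1 1≤0) ⟩
      - 1# * - 1#  ≈⟨ -1*x≈-x (- 1#) ⟩
      - - 1#       ≈⟨ -‿involutive 1# ⟩
      1#           ∎

  0≤1 : 0# ≤ 1#
  0≤1 = <⇒≤ 0<1

  >⇒≉ : ∀ {x y} → x < y → ¬ y ≈ x
  >⇒≉ (_ , x≉y) y≈x = x≉y (sym y≈x)

  ⁻¹-inverseˡ : ∀ {x} → 0# < x → x ⁻¹ * x ≈ 1#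
  ⁻¹-inverseˡ {x} 0<x = trans (*-comm (x ⁻¹) x) (⁻¹-inverse x (>⇒≉ 0<x))

  ⁻¹-cancelˡ : ∀ {x} → 0# < x → ∀ y → x ⁻¹ * (x * y) ≈ y
  ⁻¹-cancelˡ {x} 0<x y =
    trans (sym (*-assoc (x ⁻¹) x y)) (trans (*-congʳ (⁻¹-inverseˡ 0<x)) (*-identityˡ y))

  ⁻¹-cancelʳ : ∀ {x} → 0# < x → ∀ y → x * (x ⁻¹ * y) ≈ y
  ⁻¹-cancelʳ {x} 0<x y =
    trans (x∙yz≈y∙xz x (x ⁻¹) y) (⁻¹-cancelˡ 0<x y)

  ⁻¹-pos : ∀ {x} → 0# < x → 0# < x ⁻¹
  ⁻¹-pos {x} 0<x = ≰⇒> λ x⁻¹≤0 → <⇒≱ 0<1 (begin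
    1#        ≈⟨ ⁻¹-inverse x (>⇒≉ 0<x) ⟨
    x * x ⁻¹  ≤⟨ *-monoʳ-≤ (<⇒≤ 0<x) x⁻¹≤0 ⟩
    x * 0#    ≈⟨ zeroʳ x ⟩
    0#        ∎)
    where open ≤-Reasoning

  *-cancelˡ-≤ : ∀ {x y z} → 0# < x → x * y ≤ x * z → y ≤ z
  *-cancelˡ-≤ {x} {y} {z} 0<x xy≤xz = begin
    y               ≈⟨ ⁻¹-cancelˡ 0<x y ⟨
    x ⁻¹ * (x * y)  ≤⟨ *-monoʳ-≤ (<⇒≤ (⁻¹-pos 0<x)) xy≤xz ⟩
    x ⁻¹ * (x * z)  ≈⟨ ⁻¹-cancelˡ 0<x z ⟩
    z               ∎
    where open ≤-Reasoning

  *-monoʳ-< : ∀ {x y z} → 0# < x → y < z → x * y < x * z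
  *-monoʳ-< 0<x y<z = ≰⇒> (<⇒≱ y<z ∘ *-cancelˡ-≤ 0<x)

  *-monoˡ-< : ∀ {x y z} → 0# < x → y < z → y * x < z * x
  *-monoˡ-< {x} {y} {z} 0<x y<z =
    <-respˡ-≈ (*-comm x y) (<-respʳ-≈ (*-comm x z) (*-monoʳ-< 0<x y<z))

  *-pos : ∀ {x y} → 0# < x → 0# < y → 0# < x * y
  *-pos {x} 0<x 0<y = <-respˡ-≈ (zeroʳ x) (*-monoʳ-< 0<x 0<y)

  s*x<x : ∀ {s x} → s < 1# → 0# < x → s * x < x
  s*x<x {s} {x} s<1 0<x = <-respʳ-≈ (*-identityˡ x) (*-monoˡ-< 0<x s<1)

  ^-nonNeg : ∀ {x} → 0# ≤ x → ∀ n → 0# ≤ x ^ n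
  ^-nonNeg 0≤x zero    = 0≤1
  ^-nonNeg 0≤x (suc n) = *-nonNeg 0≤x (^-nonNeg 0≤x n)

  ^-pos : ∀ {x} → 0# < x → ∀ n → 0# < x ^ n
  ^-pos 0<x zero    = 0<1
  ^-pos 0<x (suc n) = *-pos 0<x (^-pos 0<x n)

  ^-monoˡ-≤ : ∀ n {x y} → 0# ≤ x → x ≤ y → x ^ n ≤ y ^ n
  ^-monoˡ-≤ zero    0≤x x≤y = ≤-refl
  ^-monoˡ-≤ (suc n) 0≤x x≤y =
    *-mono-≤ (≤-trans 0≤x x≤y) (^-nonNeg 0≤x n) x≤y (^-monoˡ-≤ n 0≤x x≤y)

  1^n≈1 : ∀ n → 1# ^ n ≈ 1#
  1^n≈1 zero    = refl
  1^n≈1 (suc n) = trans (*-identityˡ (1# ^ n)) (1^n≈1 n)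

  x<x+1 : ∀ x → x < x + 1#
  x<x+1 x = <-respˡ-≈ (+-identityʳ x) (+-monoʳ-< x 0<1)

  abstract
    dense : ∀ {x y} → x < y → ∃[ z ] x < z × z < y
    dense {x} {y} x<y = (x + y) * h , x<z , z<y
      where
      open ≤-Reasoning
      0<2 : 0# < 1# + 1#
      0<2 = ≤-<-trans 0≤1 (x<x+1 1#)
      h : Carrier
      h = (1# + 1#) ⁻¹
      halve : ∀ z → (z + z) * h ≈ z
      halve z = begin-equality
        (z + z) * h            ≈⟨ *-congʳ (+-cong (*-identityʳ z) (*-identityʳ z)) ⟨
        (z * 1# + z * 1#) * h  ≈⟨ *-congʳ (distribˡ z 1# 1#) ⟨
        z * (1# + 1#) * h      ≈⟨ *-assoc z (1# + 1#) h ⟩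
        z * ((1# + 1#) * h)    ≈⟨ *-congˡ (⁻¹-inverse (1# + 1#) (>⇒≉ 0<2)) ⟩
        z * 1#                 ≈⟨ *-identityʳ z ⟩
        z                      ∎
      x<z : x < (x + y) * h
      x<z = <-respˡ-≈ (halve x) (*-monoˡ-< (⁻¹-pos 0<2) (+-monoʳ-< x x<y))
      z<y : (x + y) * h < y
      z<y = <-respʳ-≈ (halve y) (*-monoˡ-< (⁻¹-pos 0<2) (+-mono-<-≤ x<y ≤-refl))

  record Contraction : Set (c ⊔ ℓ₁ ⊔ ℓ₂) where
    constructor contraction
    field
      factor : Carrier
      pos    : 0# < factor
      <1     : factor < 1#

  open Contraction public

  join : ∀ (s t : Contraction) → ∃[ u ] factor s ≤ factor u × factor t ≤ factor u
  join s t =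
    [ (λ s≤t → t , s≤t , ≤-refl) , (λ t≤s → s , ≤-refl , t≤s) ]′ (total (factor s) (factor t))

  abstract
    -- Replaces the continuity arguments: a strict inequality survives scaling by
    -- a power of some s < 1.
    shrink : ∀ m {x y} → 0# ≤ x → x < y → ∃[ s ] x < factor s ^ m * y
    shrink zero    {x} {y} 0≤x x<y =
      let s , 0<s , s<1 = dense 0<1
      in contraction s 0<s s<1 , <-respʳ-≈ (sym (*-identityˡ y)) x<y
    shrink (suc m) {x} {y} 0≤x x<y = s , (begin-strict
      x                                        <⟨ x<z ⟩
      z                                        ≈⟨ ⁻¹-cancelʳ 0<w z ⟨
      w * (w ⁻¹ * z)                           ≈⟨ *-comm w (w ⁻¹ * z) ⟩
      factor s₀ * w                            ≤⟨ *-mono-≤ (<⇒≤ (pos s)) (<⇒≤ 0<w) s₀≤s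
                                                    (*-monoˡ-≤ 0≤y (^-monoˡ-≤ m (<⇒≤ (pos s₁)) s₁≤s)) ⟩
      factor s * (factor s ^ m * y)            ≈⟨ *-assoc (factor s) (factor s ^ m) y ⟨
      factor s ^ suc m * y                     ∎)
      where
      open ≤-Reasoning
      0<y : 0# < y
      0<y = ≤-<-trans 0≤x x<y
      0≤y : 0# ≤ y
      0≤y = <⇒≤ 0<y
      -- With `w = s₁ ^ m * y > x` from the induction and `z` strictly between `x` and `w`, the
      -- factor `s₀ = z / w` gives `s₀ * w = z > x`. The larger of `s₀` and `s₁` serves for both.
      s₁ : Contraction
      s₁ = proj₁ (shrink m 0≤x x<y)
      w : Carrier
      w = factor s₁ ^ m * y
      x<w : x < w
      x<w = proj₂ (shrink m 0≤x x<y)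
      0<w : 0# < w
      0<w = ≤-<-trans 0≤x x<w
      z : Carrier
      z = proj₁ (dense x<w)
      x<z : x < z
      x<z = proj₁ (proj₂ (dense x<w))
      0<z : 0# < z
      0<z = ≤-<-trans 0≤x x<z
      s₀ : Contraction
      s₀ = contraction (w ⁻¹ * z) (*-pos (⁻¹-pos 0<w) 0<z)
        (<-respʳ-≈ (⁻¹-inverseˡ 0<w) (*-monoʳ-< (⁻¹-pos 0<w) (proj₂ (proj₂ (dense x<w)))))
      s : Contraction
      s = proj₁ (join s₀ s₁)
      s₀≤s : factor s₀ ≤ factor s
      s₀≤s = proj₁ (proj₂ (join s₀ s₁))
      s₁≤s : factor s₁ ≤ factor s
      s₁≤s = proj₂ (proj₂ (join s₀ s₁))

-- Classical reasoning over finite index sets.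

module DoubleNegation where
  infixl 1 _>>=_

  _>>=_ : ∀ {a b} {A : Set a} {B : Set b} → ¬ ¬ A → (A → ¬ ¬ B) → ¬ ¬ B
  (m >>= f) ¬b = m λ a → f a ¬b

  return : ∀ {a} {A : Set a} → A → ¬ ¬ A
  return a ¬a = ¬a a

  -- The state is improved once per index, and each improvement along `≼` preserves what was secured
  -- for the indices treated before. This replaces taking a minimum, maximum or common refinement of
  -- finitely many choices.
  exhaust : ∀ {a ℓ p n} {A : Set a} (_≼_ : Rel A ℓ) (P : Fin n → A → Set p) →
            (∀ {i a b} → a ≼ b → P i a → P i b) →
            (∀ i a → ¬ ¬ (∃[ b ] a ≼ b × P i b)) →
            A → ¬ ¬ (∃[ a ] (∀ i → P i a))
  exhaust {n = zero}  _≼_ P up step a = return (a , λ ())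
  exhaust {n = suc n} _≼_ P up step a = do
    b , all ← exhaust _≼_ (P ∘ suc) up (step ∘ suc) a
    c , b≼c , now ← step zero b
    return (c , λ { zero → now ; (suc i) → up b≼c (all i) })

  -- The state is a vertex of `U` that is replaced whenever the next index beats it. Stated for any
  -- total transitive relation, so that it yields minima and maxima alike.
  extremum : ∀ {ℓ n} {U : Subset n} (_≼_ : Rel (Fin n) ℓ) → Total _≼_ → Transitive _≼_ →
             Nonempty U → ¬ ¬ (∃[ m ] m ∈ U × (∀ {j} → j ∈ U → m ≼ j))
  extremum {U = U} _≼_ ≼-total ≼-trans nonempty = do
    (m , m∈U) , extremal ← exhaust (λ a b → proj₁ b ≼ proj₁ a) (λ j a → j ∈ U → proj₁ a ≼ j)
      (λ b≼a a≼j j∈U → ≼-trans b≼a (a≼j j∈U)) step nonempty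
    return (m , m∈U , λ {j} → extremal j)
    where
    ≼-refl : ∀ {i} → i ≼ i
    ≼-refl {i} = [ id , id ]′ (≼-total i i)
    step : ∀ j (a : Nonempty U) → ¬ ¬ (∃[ b ] proj₁ b ≼ proj₁ a × (j ∈ U → proj₁ b ≼ j))
    step j (m , m∈U) with j ∈? U | ≼-total m j
    ... | no j∉U  | _        = return ((m , m∈U) , ≼-refl , λ j∈U → contradiction j∈U j∉U)
    ... | yes _   | inj₁ m≼j = return ((m , m∈U) , ≼-refl , λ _ → m≼j)
    ... | yes j∈U | inj₂ j≼m = return ((j , j∈U) , j≼m , λ _ → ≼-refl)

  -- Double negation commutes with finite products.
  finite-choice : ∀ {p n} {P : Fin n → Set p} → (∀ i → ¬ ¬ P i) → ¬ ¬ (∀ i → P i)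
  finite-choice = Fin.sequence (RawMonad.rawApplicative ¬¬-Monad)

-- Nonlinear Perron-Frobenius theory by the Collatz-Wielandt method.

module PerronFrobenius {c ℓ₁ ℓ₂} (R : RealField c ℓ₁ ℓ₂) where
  open OrderedField R

  -- The properties of the tensor map that the eigenvector argument uses. Since `map-mono` compares
  -- vectors on `U` only, the values at vectors nonnegative on `U` depend on the coordinates in `U`
  -- alone. The growth estimate `map-bound` takes the place of compactness.
  record IrreducibleMap {n} (U : Subset n) (k : ℕ) : Set (c ⊔ ℓ₁ ⊔ ℓ₂ ⊔ lsuc 0ℓ) where
    field
      Edge       : Rel (Fin n) 0ℓ
      source     : ∀ {i j} → Edge i j → i ∈ U
      target     : ∀ {i j} → Edge i j → j ∈ U
      neighbour  : ∀ {i} → i ∈ U → ∃[ j ] Edge i j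
      connected  : ∀ {i j} → i ∈ U → j ∈ U → Star Edge i j
      map        : Vector Carrier n → Vector Carrier n
      map-nonNeg : ∀ {x i} → (∀ {j} → j ∈ U → 0# ≤ x j) → 0# ≤ map x i
      map-mono   : ∀ {x y i} → (∀ {j} → j ∈ U → 0# ≤ x j) → (∀ {j} → j ∈ U → x j ≤ y j) →
                   map x i ≤ map y i
      map-homo   : ∀ t x i → map (λ j → t * x j) i ≈ t ^ k * map x i
      map-strict : ∀ {x y i j} → Edge i j → (∀ {l} → l ∈ U → 0# ≤ x l) →
                   (∀ {l} → l ∈ U → 0# < y l) → (∀ {l} → l ∈ U → x l ≤ y l) →
                   x j < y j → map x i < map y i
      coeff      : Carrier
      coeff-pos  : 0# < coeff
      map-bound  : ∀ {x i j} → Edge i j → (∀ {l} → l ∈ U → 1# ≤ x l) → coeff * x j ≤ map x i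

  module Perron {n} {U : Subset n} {k} (M : IrreducibleMap U k) (nonempty : Nonempty U) where
    open IrreducibleMap M
    open DoubleNegation

    SuperEigenvector : Carrier → Vector Carrier n → Set (ℓ₁ ⊔ ℓ₂)
    SuperEigenvector λ′ y = ∀ {i} → i ∈ U → 0# < y i × map y i ≤ λ′ * y i ^ k

    -- Only the bound `1# ≤ y i` is imposed, not that `1#` is attained: a pointwise infimum of
    -- vectors attaining it at different vertices need not attain it.
    Feasible : Carrier → Vector Carrier n → Set (ℓ₁ ⊔ ℓ₂)
    Feasible λ′ y = SuperEigenvector λ′ y × (∀ {i} → i ∈ U → 1# ≤ y i)

    weaken : ∀ {λ₁ λ₂ y} → λ₁ ≤ λ₂ → Feasible λ₁ y → Feasible λ₂ y
    weaken {y = y} λ₁≤λ₂ (super , y≥1) =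
      (λ i∈U → let y>0 , le = super i∈U
               in y>0 , ≤-trans le (*-monoˡ-≤ (^-nonNeg (<⇒≤ y>0) k) λ₁≤λ₂)) , y≥1

    -- Division by the smallest entry on `U`; both sides of the inequality are homogeneous of degree
    -- `k`.
    normalise : ∀ {λ′ y} → SuperEigenvector λ′ y →
                ¬ ¬ (∃[ z ] Feasible λ′ z × (∃[ m ] m ∈ U × z m ≤ 1#))
    normalise {λ′} {y} super = do
      m , m∈U , least ← extremum (λ i j → y i ≤ y j) (λ i j → total (y i) (y j)) ≤-trans nonempty
      let t   = y m ⁻¹
          0<t = ⁻¹-pos (proj₁ (super m∈U))
          t*m = ⁻¹-inverseˡ (proj₁ (super m∈U))
      return ( (λ j → t * y j)
             , ( (λ {i} i∈U → *-pos 0<t (proj₁ (super i∈U)) , (begin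
                   map (λ j → t * y j) i      ≈⟨ map-homo t y i ⟩
                   t ^ k * map y i            ≤⟨ *-monoʳ-≤ (^-nonNeg (<⇒≤ 0<t) k) (proj₂ (super i∈U)) ⟩
                   t ^ k * (λ′ * y i ^ k)     ≈⟨ x∙yz≈y∙xz (t ^ k) λ′ (y i ^ k) ⟩
                   λ′ * (t ^ k * y i ^ k)     ≈⟨ *-congˡ (^-distrib-* t (y i) k) ⟨
                   λ′ * (t * y i) ^ k         ∎))
               , (λ {i} i∈U → begin
                   1#       ≈⟨ t*m ⟨
                   t * y m  ≤⟨ *-monoʳ-≤ (<⇒≤ 0<t) (least i∈U) ⟩
                   t * y i  ∎))
             , m , m∈U , ≤-reflexive t*m)
      where open ≤-Reasoning

    -- At a vertex where the normalised vector equals `1#`, the right side is `λ′`, while the left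
    -- side is at least `coeff` times the entry of a neighbour, itself at least `1#`. This keeps the
    -- infimum positive.
    coeff≤ : ∀ {λ′ y} → SuperEigenvector λ′ y → coeff ≤ λ′
    coeff≤ {λ′} super = decidable-stable (coeff ≤? λ′) do
      z , (super′ , z≥1) , m , m∈U , zm≤1 ← normalise super
      let j , e = neighbour m∈U
      return (begin
        coeff            ≈⟨ *-identityʳ coeff ⟨
        coeff * 1#       ≤⟨ *-monoʳ-≤ (<⇒≤ coeff-pos) (z≥1 (target e)) ⟩
        coeff * z j      ≤⟨ map-bound e z≥1 ⟩
        map z m          ≤⟨ proj₂ (super′ m∈U) ⟩
        λ′ * z m ^ k     ≈⟨ *-congˡ (^-congˡ k (≤-antisym zm≤1 (z≥1 m∈U))) ⟩
        λ′ * 1# ^ k      ≈⟨ *-congˡ (1^n≈1 k) ⟩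
        λ′ * 1#          ≈⟨ *-identityʳ λ′ ⟩
        λ′               ∎)
      where open ≤-Reasoning

    -- The constant vector `1#` is feasible for any upper bound of the entries of its image.
    feasible-exists : ¬ ¬ (∃[ λ′ ] ∃ (Feasible λ′))
    feasible-exists = do
      b , bound ← exhaust _≤_ (λ i b → map (λ _ → 1#) i ≤ b) (λ a≤b le → ≤-trans le a≤b)
        (λ i a → [ (λ le → return (_ , le , ≤-refl)) , (λ le → return (a , ≤-refl , le)) ]′
                   (total a (map (λ _ → 1#) i))) 0#
      return (b , (λ _ → 1#) , (λ {i} _ → 0<1 , (begin
        map (λ _ → 1#) i  ≤⟨ bound i ⟩
        b                 ≈⟨ *-identityʳ b ⟨
        b * 1#            ≈⟨ *-congˡ (1^n≈1 k) ⟨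
        b * 1# ^ k        ∎)) , λ {_} _ → ≤-refl)
      where open ≤-Reasoning

    -- Feasibility passes to larger values, so the supremum of this predicate is the infimum of the
    -- feasible values.
    Infeasible : Pred Carrier (c ⊔ ℓ₁ ⊔ ℓ₂)
    Infeasible λ′ = ¬ ∃ (Feasible λ′)

    feasible⇒upper : ∀ {λ′ y} → Feasible λ′ y → UpperBound Infeasible λ′
    feasible⇒upper {λ′} feasible λ″ infeasible = ≮⇒≥ λ λ′<λ″ →
      infeasible (_ , weaken (<⇒≤ λ′<λ″) feasible)

    infimum-exists : ¬ ¬ (∃[ μ ] 0# < μ
                          × (∀ {λ′ y} → SuperEigenvector λ′ y → μ ≤ λ′)
                          × (∀ {λ′} → μ < λ′ → ¬ ¬ ∃ (Feasible λ′)))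
    infimum-exists = do
      λ₀ , y₀ , feasible₀ ← feasible-exists
      -- By `coeff≤` the value `d` is infeasible: it makes the predicate inhabited and puts a
      -- positive number below its supremum.
      let d , 0<d , d<coeff = dense coeff-pos
          infeasible = λ { (_ , feasible) → <⇒≱ d<coeff (coeff≤ (proj₁ feasible)) }
          μ , upper , least = supremum Infeasible (d , infeasible) (λ₀ , feasible⇒upper feasible₀)
          minimal : ∀ {λ′ y} → SuperEigenvector λ′ y → μ ≤ λ′
          minimal {λ′} {y} super = decidable-stable (μ ≤? λ′) do
            _ , feasible , _ ← normalise {λ′} {y} super
            return (least λ′ (feasible⇒upper feasible))
          above : ∀ {λ′} → μ < λ′ → ¬ ¬ ∃ (Feasible λ′)
          above {λ′} μ<λ′ none = <⇒≱ μ<λ′ (upper λ′ none)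
      return (μ , (begin-strict 0# <⟨ 0<d ⟩ d ≤⟨ upper d infeasible ⟩ μ ∎)
                , (λ {λ′} {y} → minimal {λ′} {y}) , λ {λ′} → above {λ′})
      where open ≤-Reasoning

    -- Attainment of the infimum.

    module _ {μ} (μ>0 : 0# < μ)
             (μ≤ : ∀ {λ′ y} → SuperEigenvector λ′ y → μ ≤ λ′)
             (feasible-above : ∀ {λ′} → μ < λ′ → ¬ ¬ ∃ (Feasible λ′)) where

      -- Along an edge from `i` to `j`, `coeff * y j ≤ map y i ≤ (μ + 1#) * y i ^
      -- k`, so a bound at `i` gives one at `j` that is the same for all feasible `y`. The value `μ
      -- + 1#` is an arbitrary fixed one above `μ`.
      path-bound : ∀ {i j} → Star Edge i j → ∀ b →
                   ∃[ b′ ] (∀ {y} → Feasible (μ + 1#) y → y i ≤ b → y j ≤ b′)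
      path-bound ε                 b = b , λ _ le → le
      path-bound (_◅_ {i} {j} e p) b =
        let b′ , bound = path-bound p (coeff ⁻¹ * ((μ + 1#) * b ^ k))
        in b′ , λ feasible le → bound feasible (next feasible le)
        where
        open ≤-Reasoning
        next : ∀ {y} → Feasible (μ + 1#) y → y i ≤ b → y j ≤ coeff ⁻¹ * ((μ + 1#) * b ^ k)
        next {y} (super , y≥1) le = *-cancelˡ-≤ coeff-pos (begin
          coeff * y j                                    ≤⟨ map-bound e y≥1 ⟩
          map y i                                        ≤⟨ proj₂ (super (source e)) ⟩
          (μ + 1#) * y i ^ k                             ≤⟨ *-monoʳ-≤ (<⇒≤ (<-trans μ>0 (x<x+1 μ)))
                                                              (^-monoˡ-≤ k (<⇒≤ (proj₁ (super (source e)))) le) ⟩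
          (μ + 1#) * b ^ k                               ≈⟨ ⁻¹-cancelʳ coeff-pos _ ⟨
          coeff * (coeff ⁻¹ * ((μ + 1#) * b ^ k))        ∎)

      -- The vertex `m` where a normalised vector is at most `1#` varies with the vector, so the
      -- path bounds from all `m` are combined into their maximum.
      normalised-bound : ∀ {i} → i ∈ U →
        ¬ ¬ (∃[ b ] (∀ m → ∀ {y} → Feasible (μ + 1#) y → m ∈ U → y m ≤ 1# → y i ≤ b))
      normalised-bound {i} i∈U = exhaust _≤_
        (λ m b → ∀ {y} → Feasible (μ + 1#) y → m ∈ U → y m ≤ 1# → y i ≤ b)
        (λ a≤b bound feasible m∈U le → ≤-trans (bound feasible m∈U le) a≤b) step 0#
        where
        step : ∀ m a → ¬ ¬ (∃[ b ] a ≤ b ×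
               (∀ {y} → Feasible (μ + 1#) y → m ∈ U → y m ≤ 1# → y i ≤ b))
        step m a with m ∈? U
        ... | no m∉U  = return (a , ≤-refl , λ {_} _ m∈U → contradiction m∈U m∉U)
        ... | yes m∈U with path-bound (connected m∈U i∈U) 1#
        ...   | b , bound with total a b
        ...     | inj₁ a≤b = return (b , a≤b , λ {_} feasible _ → bound feasible)
        ...     | inj₂ b≤a = return (a , ≤-refl , λ {_} feasible _ le → ≤-trans (bound feasible le) b≤a)

      -- The supremum of LowerLimit i is the limit, as λ′ decreases to μ, of the
      -- infimum of y i over all feasible y.
      LowerLimit : Fin n → Pred Carrier (c ⊔ ℓ₁ ⊔ ℓ₂)
      LowerLimit i r = ∃[ λ′ ] μ < λ′ × (∀ {y} → Feasible λ′ y → r ≤ y i)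

      1∈LowerLimit : ∀ {i} → i ∈ U → LowerLimit i 1#
      1∈LowerLimit i∈U = μ + 1# , x<x+1 μ , λ feasible → proj₂ feasible i∈U

      -- A lower bound valid at `λ′` applies in particular to a normalised vector feasible for the
      -- smaller of `λ′` and `μ + 1#`, whose entry at `i` is at most `b`.
      LowerLimit-bounded : ∀ {i} → i ∈ U → ¬ ¬ Satisfiable (UpperBound (LowerLimit i))
      LowerLimit-bounded {i} i∈U = do
        b , bound ← normalised-bound i∈U
        return (b , λ { r (λ′ , μ<λ′ , lower) → decidable-stable (r ≤? b)
          (let λ″ , μ<λ″ , λ″≤λ′ , λ″≤μ+1 = below μ<λ′ in do
            y , feasible ← feasible-above μ<λ″
            z , feasible′ , m , m∈U , zm≤1 ← normalise (proj₁ feasible)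
            return (≤-trans (lower (weaken λ″≤λ′ feasible′))
                            (bound m (weaken λ″≤μ+1 feasible′) m∈U zm≤1))) })
        where
        below : ∀ {λ′} → μ < λ′ → ∃[ λ″ ] μ < λ″ × λ″ ≤ λ′ × λ″ ≤ μ + 1#
        below {λ′} μ<λ′ = [ (λ le → λ′ , μ<λ′ , ≤-refl , le) , (λ le → μ + 1# , x<x+1 μ , le , ≤-refl) ]′
          (total λ′ (μ + 1#))

      IsSupremum : Pred Carrier (c ⊔ ℓ₁ ⊔ ℓ₂) → Carrier → Set (c ⊔ ℓ₁ ⊔ ℓ₂)
      IsSupremum S s = UpperBound S s × (∀ b → UpperBound S b → s ≤ b)

      limit-exists : ¬ ¬ (∃[ y ] (∀ {i} → i ∈ U → IsSupremum (LowerLimit i) (y i)))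
      limit-exists = do
        sup ← finite-choice sup
        return ((λ i → proj₁ (sup i)) , λ {i} → proj₂ (sup i))
        where
        sup : ∀ i → ¬ ¬ (∃[ s ] (i ∈ U → IsSupremum (LowerLimit i) s))
        sup i with i ∈? U
        -- A default value: nothing is claimed outside `U`.
        ... | no i∉U  = return (0# , λ i∈U → contradiction i∈U i∉U)
        ... | yes i∈U = do
          bounded ← LowerLimit-bounded i∈U
          let s , isSup = supremum (LowerLimit i) (1# , 1∈LowerLimit i∈U) bounded
          return (s , λ _ → isSup)

      -- If the inequality failed at `i`, it would fail with a margin. For `λ′` close to `μ` every
      -- feasible `z` is at least `s * y`, and monotonicity then forces `z i` to be at least
      -- `y i / s`, above the limit of the infima.
      limit-super : ∀ {y} → (∀ {i} → i ∈ U → IsSupremum (LowerLimit i) (y i)) → SuperEigenvector μ y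
      limit-super {y} isSup {i} i∈U = y>0 i∈U , ≮⇒≥ λ lt →
        -- Of the `2k + 1` factors, `k` pay for replacing `y` by `s * y` inside the map, one for
        -- `λ′ ≤ μ / s`, and `k` for `z i < y i / s` on the right.
        let σ , lt′ = shrink (suc k ℕ.+ k) (*-nonNeg (<⇒≤ μ>0) (^-nonNeg (<⇒≤ (y>0 i∈U)) k)) lt
        in not-scaled σ lt′
        where
        open ≤-Reasoning
        y>0 : ∀ {j} → j ∈ U → 0# < y j
        y>0 {j} j∈U = begin-strict
          0#   <⟨ 0<1 ⟩
          1#   ≤⟨ proj₁ (isSup j∈U) 1# (1∈LowerLimit j∈U) ⟩
          y j  ∎
        module _ (σ : Contraction) where
          s : Carrier
          s = factor σ
          0<s : 0# < s
          0<s = pos σ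

          -- The values above `μ` and at most `μ / s`; starting from `μ / s`, they are lowered until
          -- every coordinate in `U` is dominated.
          SlightlyAbove : Set (c ⊔ ℓ₁ ⊔ ℓ₂)
          SlightlyAbove = ∃[ λ′ ] μ < λ′ × s * λ′ ≤ μ

          Dominated : Fin n → SlightlyAbove → Set (c ⊔ ℓ₁ ⊔ ℓ₂)
          Dominated j (λ′ , _) = ∀ {z} → Feasible λ′ z → j ∈ U → s * y j ≤ z j

          initial : SlightlyAbove
          initial = s ⁻¹ * μ
            , <-respˡ-≈ (⁻¹-cancelˡ 0<s μ) (*-monoʳ-< (⁻¹-pos 0<s) (s*x<x (<1 σ) μ>0))
            , ≤-reflexive (⁻¹-cancelʳ 0<s μ)

          -- `LowerLimit j` is closed downwards, and `s * y j` lies strictly below its supremum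
          -- `y j`.
          near-supremum : ∀ {j} → j ∈ U → ¬ ¬ LowerLimit j (s * y j)
          near-supremum {j} j∈U none = <⇒≱ (s*x<x (<1 σ) (y>0 j∈U)) (proj₂ (isSup j∈U) (s * y j)
            λ { r (λ′ , μ<λ′ , lower) → ≮⇒≥ λ s*y<r →
                none (λ′ , μ<λ′ , λ feasible → ≤-trans (<⇒≤ s*y<r) (lower feasible)) })

          step : ∀ j a → ¬ ¬ (∃[ b ] proj₁ b ≤ proj₁ a × Dominated j b)
          step j a@(λ₁ , μ<λ₁ , s*λ₁≤μ) with j ∈? U
          ... | no j∉U  = return (a , ≤-refl , λ {_} _ j∈U → contradiction j∈U j∉U)
          ... | yes j∈U = do
            λ₂ , μ<λ₂ , lower ← near-supremum j∈U
            [ (λ λ₁≤λ₂ → return (a , ≤-refl , λ {_} feasible _ → lower (weaken λ₁≤λ₂ feasible)))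
              , (λ λ₂≤λ₁ → return ((λ₂ , μ<λ₂ , ≤-trans (*-monoʳ-≤ (<⇒≤ 0<s) λ₂≤λ₁) s*λ₁≤μ)
                                  , λ₂≤λ₁ , λ {_} feasible _ → lower feasible)) ]′ (total λ₁ λ₂)

          -- Otherwise y i / s would belong to LowerLimit i and exceed its supremum.
          not-scaled : ¬ (μ * y i ^ k < s ^ (suc k ℕ.+ k) * map y i)
          not-scaled lt = exhaust (λ a b → proj₁ b ≤ proj₁ a) Dominated
            (λ b≤a dominated feasible → dominated (weaken b≤a feasible)) step initial
            λ { ((λ′ , μ<λ′ , s*λ′≤μ) , dominated) →
              <⇒≱ (<-respˡ-≈ (⁻¹-cancelˡ 0<s (y i))
                     (*-monoʳ-< (⁻¹-pos 0<s) (s*x<x (<1 σ) (y>0 i∈U))))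
                  (proj₁ (isSup i∈U) (s ⁻¹ * y i) (λ′ , μ<λ′ , λ {z} feasible → ≮⇒≥ λ z<y/s →
                    <⇒≱ lt (begin
                      s ^ (suc k ℕ.+ k) * map y i      ≈⟨ *-congʳ (^-homo-* s (suc k) k) ⟩
                      s ^ suc k * s ^ k * map y i      ≈⟨ *-assoc (s ^ suc k) (s ^ k) (map y i) ⟩
                      s ^ suc k * (s ^ k * map y i)    ≈⟨ *-congˡ (map-homo s y i) ⟨
                      s ^ suc k * map (λ j → s * y j) i
                        ≤⟨ *-monoʳ-≤ (^-nonNeg (<⇒≤ 0<s) (suc k)) (map-mono
                             (λ j∈U → <⇒≤ (*-pos 0<s (y>0 j∈U))) (λ {j} → dominated j feasible)) ⟩
                      s ^ suc k * map z i
                        ≤⟨ *-monoʳ-≤ (^-nonNeg (<⇒≤ 0<s) (suc k)) (proj₂ (proj₁ feasible i∈U)) ⟩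
                      s * s ^ k * (λ′ * z i ^ k)       ≈⟨ interchange s (s ^ k) λ′ (z i ^ k) ⟩
                      s * λ′ * (s ^ k * z i ^ k)       ≈⟨ *-congˡ (^-distrib-* s (z i) k) ⟨
                      s * λ′ * (s * z i) ^ k
                        ≤⟨ *-mono-≤ (<⇒≤ μ>0)
                             (^-nonNeg (<⇒≤ (*-pos 0<s (proj₁ (proj₁ feasible i∈U)))) k) s*λ′≤μ
                             (^-monoˡ-≤ k (<⇒≤ (*-pos 0<s (proj₁ (proj₁ feasible i∈U))))
                               (≤-trans (*-monoʳ-≤ (<⇒≤ 0<s) (<⇒≤ z<y/s))
                                        (≤-reflexive (⁻¹-cancelʳ 0<s (y i))))) ⟩
                      μ * y i ^ k                      ∎))) }

      -- Equality in the limit inequality.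

      Strict : Vector Carrier n → Fin n → Set (ℓ₁ ⊔ ℓ₂)
      Strict y i = map y i < μ * y i ^ k

      -- z lowers y at l only, by so little that l stays strict.
      spread : ∀ {y j l} → SuperEigenvector μ y → Edge j l → Strict y l →
               ∃[ z ] SuperEigenvector μ z × (∀ {q} → q ∈ U → Strict y q → Strict z q) × Strict z j
      spread {y} {j} {l} super e gap = z , super′ , preserve , strict-j
        where
        open ≤-Reasoning
        y>0 : ∀ {q} → q ∈ U → 0# < y q
        y>0 q∈U = proj₁ (super q∈U)
        shrunk : ∃[ σ ] map y l < factor σ ^ k * (μ * y l ^ k)
        shrunk = shrink k (map-nonNeg (<⇒≤ ∘ y>0)) gap
        σ : Contraction
        σ = proj₁ shrunk
        s : Carrier
        s = factor σ
        z : Vector Carrier n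
        z = updateAt y l (s *_)
        z-at : ∀ {q} → q ≡ l → z q ≈ s * y q
        z-at ≡.refl = reflexive (updateAt-updates l y)
        z-off : ∀ {q} → q ≢ l → z q ≈ y q
        z-off {q} q≢l = reflexive (updateAt-minimal q l y q≢l)
        z>0 : ∀ {q} → q ∈ U → 0# < z q
        z>0 {q} q∈U with q Fin.≟ l
        ... | yes q≡l = <-respʳ-≈ (sym (z-at q≡l)) (*-pos (pos σ) (y>0 q∈U))
        ... | no q≢l  = <-respʳ-≈ (sym (z-off q≢l)) (y>0 q∈U)
        z≤y : ∀ {q} → q ∈ U → z q ≤ y q
        z≤y {q} q∈U with q Fin.≟ l
        ... | yes q≡l = ≤-respˡ-≈ (sym (z-at q≡l)) (<⇒≤ (s*x<x (<1 σ) (y>0 q∈U)))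
        ... | no q≢l  = ≤-reflexive (z-off q≢l)
        map-z≤ : ∀ {q} → map z q ≤ map y q
        map-z≤ = map-mono (<⇒≤ ∘ z>0) z≤y
        strict-at : Strict z l
        strict-at = begin-strict
          map z l              ≤⟨ map-z≤ ⟩
          map y l              <⟨ proj₂ shrunk ⟩
          s ^ k * (μ * y l ^ k)  ≈⟨ x∙yz≈y∙xz (s ^ k) μ (y l ^ k) ⟩
          μ * (s ^ k * y l ^ k)  ≈⟨ *-congˡ (^-distrib-* s (y l) k) ⟨
          μ * (s * y l) ^ k      ≈⟨ *-congˡ (^-congˡ k (z-at ≡.refl)) ⟨
          μ * z l ^ k            ∎
        off : ∀ {q} → q ≢ l → μ * y q ^ k ≈ μ * z q ^ k
        off q≢l = *-congˡ (^-congˡ k (sym (z-off q≢l)))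
        preserve : ∀ {q} → q ∈ U → Strict y q → Strict z q
        preserve {q} q∈U sq with q Fin.≟ l
        ... | yes ≡.refl = strict-at
        ... | no q≢l     = begin-strict
          map z q      ≤⟨ map-z≤ ⟩
          map y q      <⟨ sq ⟩
          μ * y q ^ k  ≈⟨ off q≢l ⟩
          μ * z q ^ k  ∎
        super′ : SuperEigenvector μ z
        super′ {q} q∈U with q Fin.≟ l
        ... | yes ≡.refl = z>0 q∈U , <⇒≤ strict-at
        ... | no q≢l     = z>0 q∈U , (begin
          map z q      ≤⟨ map-z≤ ⟩
          map y q      ≤⟨ proj₂ (super q∈U) ⟩
          μ * y q ^ k  ≈⟨ off q≢l ⟩
          μ * z q ^ k  ∎)
        strict-j : Strict z j
        strict-j with j Fin.≟ l
        ... | yes ≡.refl = strict-at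
        -- Lowering the entry at `l` leaves the right side at `j` unchanged, and the edge makes the
        -- left side drop strictly.
        ... | no j≢l     = begin-strict
          map z j      <⟨ map-strict e (<⇒≤ ∘ z>0) y>0 z≤y
                            (<-respˡ-≈ (sym (z-at ≡.refl)) (s*x<x (<1 σ) (y>0 (target e)))) ⟩
          map y j      ≤⟨ proj₂ (super (source e)) ⟩
          μ * y j ^ k  ≈⟨ off j≢l ⟩
          μ * z j ^ k  ∎

      -- Strictness travels backwards along the path, from its end `l` to its start `j`.
      spread-path : ∀ {y j l} → SuperEigenvector μ y → Star Edge j l → Strict y l →
                    ∃[ z ] SuperEigenvector μ z × (∀ {q} → q ∈ U → Strict y q → Strict z q) × Strict z j
      spread-path {y} super ε       gap = y , super , (λ _ sq → sq) , gap
      spread-path     super (e ◅ p) gap =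
        let y′ , super′ , keep , gap′ = spread-path super p gap
            z , super″ , keep′ , gap″ = spread super′ e gap′
        in z , super″ , (λ q∈U sq → keep′ q∈U (keep q∈U sq)) , gap″

      -- Finitely many strict inequalities leave room for a common factor `s < 1#`; then `y` is a
      -- super-eigenvector for `s * μ`, against the minimality of `μ`.
      not-everywhere-strict : ∀ {y} → SuperEigenvector μ y → ¬ (∀ j → j ∈ U → Strict y j)
      not-everywhere-strict {y} super gap = exhaust (λ a b → factor a ≤ factor b)
        (λ j a → j ∈ U → map y j ≤ factor a * (μ * y j ^ k))
        (λ {j} a≤b le j∈U → ≤-trans (le j∈U) (*-monoˡ-≤ (<⇒≤ (μy>0 j∈U)) a≤b))
        -- The call of `shrink` only supplies some factor below `1#` to start from.
        step (proj₁ (shrink 0 ≤-refl 0<1))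
        λ { (σ , le) → <⇒≱ (s*x<x (<1 σ) μ>0)
              (μ≤ λ {j} j∈U → proj₁ (super j∈U)
                 , ≤-trans (le j j∈U) (≤-reflexive (sym (*-assoc (factor σ) μ (y j ^ k))))) }
        where
        μy>0 : ∀ {j} → j ∈ U → 0# < μ * y j ^ k
        μy>0 j∈U = *-pos μ>0 (^-pos (proj₁ (super j∈U)) k)
        step : ∀ j a → ¬ ¬ (∃[ b ] factor a ≤ factor b ×
                               (j ∈ U → map y j ≤ factor b * (μ * y j ^ k)))
        step j a with j ∈? U
        ... | no j∉U  = return (a , ≤-refl , λ j∈U → contradiction j∈U j∉U)
        ... | yes j∈U =
          let σ , lt = shrink 1 (map-nonNeg (λ l∈U → <⇒≤ (proj₁ (super l∈U)))) (gap j j∈U)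
              b , a≤b , σ≤b = join a σ
          in return (b , a≤b , λ _ → ≤-trans (<⇒≤ lt) (*-monoˡ-≤ (<⇒≤ (μy>0 j∈U))
               (≤-trans (≤-reflexive (*-identityʳ (factor σ))) σ≤b)))

      -- A vertex without equality is strict, and strictness spreads to each `j` in turn along a
      -- path from `j` to `i`. The state keeps `i` strict for the next path, and `≼` says that no
      -- strict vertex is lost.
      tight : ∀ {y} → SuperEigenvector μ y → ∀ {i} → i ∈ U → map y i ≈ μ * y i ^ k
      tight {y} super {i} i∈U = decidable-stable (map y i ≟ μ * y i ^ k) λ ≉ →
        exhaust _≼_ (λ j a → j ∈ U → Strict (proj₁ a) j) (λ keep gap j∈U → keep j∈U (gap j∈U))
          step (y , super , proj₂ (super i∈U) , ≉)
          λ { ((z , super′ , _) , gap) → not-everywhere-strict super′ gap }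
        where
        State : Set _
        State = ∃[ z ] SuperEigenvector μ z × Strict z i
        _≼_ : Rel State _
        a ≼ b = ∀ {q} → q ∈ U → Strict (proj₁ a) q → Strict (proj₁ b) q
        step : ∀ j a → ¬ ¬ (∃[ b ] a ≼ b × (j ∈ U → Strict (proj₁ b) j))
        step j a@(_ , super , gap) with j ∈? U
        ... | no j∉U  = return (a , (λ {_} _ sq → sq) , λ j∈U → contradiction j∈U j∉U)
        ... | yes j∈U with spread-path super (connected j∈U i∈U) gap
        ...   | z , super′ , keep , gap′ = return (b , (λ {q} → keep {q}) , λ _ → gap′)
          where
          b : State
          b = z , super′ , keep i∈U gap

    eigenvector : ¬ ¬ (∃[ μ ] ∃[ y ] 0# < μ ×
                       (∀ i → i ∈ U → 0# < y i × map y i ≈ μ * y i ^ k))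
    eigenvector = do
      μ , μ>0 , μ≤ , feasible-above ← infimum-exists
      y , isSup ← limit-exists μ>0 μ≤ feasible-above
      let super : SuperEigenvector μ y
          super = limit-super μ>0 μ≤ feasible-above isSup
      return (μ , y , μ>0 , λ i i∈U → proj₁ (super i∈U) , tight μ>0 μ≤ feasible-above super i∈U)

-- Counting subsets by tuples of distinct elements.

module SubsetEnumeration where

  ⟨_⟩ : ∀ {p n} {P : Pred (Fin n) p} → Decidable P → Subset n
  ⟨ P? ⟩ = Vec.tabulate (does ∘ P?)

  ∈⟨⟩⁺ : ∀ {p n} {P : Pred (Fin n) p} (P? : Decidable P) {i} → P i → i ∈ ⟨ P? ⟩
  ∈⟨⟩⁺ P? {i} Pi = lookup⇒[]= i _ (≡.trans (lookup∘tabulate (does ∘ P?) i) (dec-true (P? i) Pi))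

  ∈⟨⟩⁻ : ∀ {p n} {P : Pred (Fin n) p} (P? : Decidable P) {i} → i ∈ ⟨ P? ⟩ → P i
  ∈⟨⟩⁻ P? {i} i∈ with P? i | ≡.trans (≡.sym (lookup∘tabulate (does ∘ P?) i)) ([]=⇒lookup i∈)
  ... | yes Pi | _ = Pi

  -- Position by position: only at `i` may `p` have an element that `q` misses.
  ∣p∣≤1+∣q∣ : ∀ {n} {p q : Subset n} i → (∀ {j} → j ∈ p → j ≢ i → j ∈ q) → ∣ p ∣ ℕ.≤ suc ∣ q ∣
  ∣p∣≤1+∣q∣ {p = s ∷ p} {t ∷ q} zero p⊆ = begin
    ∣ s ∷ p ∣        ≤⟨ count≤1+count s p ⟩
    suc ∣ p ∣        ≤⟨ s≤s (p⊆q⇒∣p∣≤∣q∣ (λ j∈p → drop-there (p⊆ (there j∈p) λ ()))) ⟩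
    suc ∣ q ∣        ≤⟨ s≤s (∣p∣≤∣x∷p∣ t q) ⟩
    suc ∣ t ∷ q ∣    ∎
    where
    open ℕ.≤-Reasoning
    count≤1+count : ∀ {n} s (p : Subset n) → ∣ s ∷ p ∣ ℕ.≤ suc ∣ p ∣
    count≤1+count outside p = ℕ.n≤1+n ∣ p ∣
    count≤1+count inside  p = ℕ.≤-refl
  ∣p∣≤1+∣q∣ {p = outside ∷ p} {t ∷ q} (suc i) p⊆ = ℕ.≤-trans
    (∣p∣≤1+∣q∣ i λ j∈p j≢i → drop-there (p⊆ (there j∈p) (j≢i ∘ Fin.suc-injective))) (s≤s (∣p∣≤∣x∷p∣ t q))
  ∣p∣≤1+∣q∣ {p = inside ∷ p} {t ∷ q} (suc i) p⊆ with p⊆ here (λ ())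
  ... | here = s≤s (∣p∣≤1+∣q∣ i λ j∈p j≢i → drop-there (p⊆ (there j∈p) (j≢i ∘ Fin.suc-injective)))

  i∉p-i : ∀ {n} {p : Subset n} {i} → i ∈ p → i ∉ p - i
  i∉p-i {p = p} {i} i∈p i∈ = ℕ.<⇒≱ (x∈p⇒∣p-x∣<∣p∣ i∈p) (p⊆q⇒∣p∣≤∣q∣ p⊆)
    where
    p⊆ : p ⊆ˢ p - i
    p⊆ {j} j∈p with j Fin.≟ i
    ... | yes ≡.refl = i∈
    ... | no j≢i   = x∈p∧x≢y⇒x∈p-y j∈p j≢i

  -- The tail of the tuple avoids its head, so it lies in `p` with the head removed.
  unique⇒≤∣p∣ : ∀ {m n} {is : Vec (Fin n) m} {p} → Unique is → All (_∈ p) is → m ℕ.≤ ∣ p ∣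
  unique⇒≤∣p∣ []                []          = z≤n
  unique⇒≤∣p∣ (i∉is ∷ uniq) (i∈p ∷ is∈p) =
    ℕ.≤-trans (s≤s (unique⇒≤∣p∣ uniq (All.map (λ (j∈p , i≢j) → x∈p∧x≢y⇒x∈p-y j∈p (i≢j ∘ ≡.sym))
      (All.zip (is∈p , i∉is))))) (x∈p⇒∣p-x∣<∣p∣ i∈p)

  enumerate : ∀ m {n} {p : Subset n} → m ℕ.≤ ∣ p ∣ →
              ∃[ is ] Unique {n = m} is × All (_∈ p) is
  -- The prescribed first element serves to find a nonzero tensor entry through a given edge.
  enumerate-from : ∀ m {n} {p : Subset n} {j} → suc m ℕ.≤ ∣ p ∣ → j ∈ p →
                   ∃[ is ] Unique {n = suc m} (j ∷ is) × All (_∈ p) (j ∷ is)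

  enumerate zero    _ = [] , [] , []
  enumerate (suc m) {n} {p} m<∣p∣ with nonempty? p
  ... | yes (j , j∈p) = let is , uniq , is∈p = enumerate-from m m<∣p∣ j∈p in j ∷ is , uniq , is∈p
  ... | no empty      = contradiction
    (ℕ.≤-trans m<∣p∣ (ℕ.≤-reflexive (≡.trans (≡.cong ∣_∣ (Empty-unique empty)) (∣⊥∣≡0 n)))) λ ()

  enumerate-from m {p = p} {j} m<∣p∣ j∈p =
    let is , uniq , is∈ = enumerate m (ℕ.≤-pred (ℕ.≤-trans m<∣p∣ (∣p∣≤1+∣q∣ {p = p} j x∈p∧x≢y⇒x∈p-y)))
    in is
     , All.map (λ { i∈ ≡.refl → i∉p-i {p = p} j∈p i∈ }) is∈ ∷ uniq
     , j∈p ∷ All.map (p─q⊆p p ⁅ j ⁆) is∈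

-- Degrees in the core and its components.

module Neighbourhoods {n} (G : Graph n) where
  open SubsetEnumeration
  open Graph G using (Adj; adj?) renaming (sym to adj-sym)

  N : Fin n → Subset n
  N i = ⟨ adj? i ⟩

  ∈N∩⁺ : ∀ {i j W} → Adj i j → j ∈ W → j ∈ N i ∩ W
  ∈N∩⁺ i~j j∈W = x∈p∩q⁺ (∈⟨⟩⁺ (adj? _) i~j , j∈W)

  ∈N∩⁻ : ∀ {i j W} → j ∈ N i ∩ W → Adj i j × j ∈ W
  ∈N∩⁻ {i} {W = W} j∈ = let j∈N , j∈W = x∈p∩q⁻ (N i) W j∈ in ∈⟨⟩⁻ (adj? i) j∈N , j∈W

  -- `degree` and `connected` make the tensor map irreducible on `U`; `sparse` makes an eigenvector
  -- on `U` extend by zero to all of `G`.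
  record CoreComponent (k : ℕ) (U : Subset n) : Set where
    field
      degree    : ∀ {i} → i ∈ U → k ℕ.≤ ∣ N i ∩ U ∣
      sparse    : ∀ {i} → i ∉ U → ∣ N i ∩ U ∣ ℕ.< k
      connected : Subgraph.Connected (G [ U ])

  module _ {k} (C : Subgraph G) (C-core : IsCore k C) where
    open Subgraph C using () renaming (verts to V)

    core-degree : ∀ {i} → i ∈ V → k ℕ.≤ ∣ N i ∩ V ∣
    core-degree {i} i∈V = ℕ.≤-trans (proj₁ C-core i∈V) (p⊆q⇒∣p∣≤∣q∣ λ j∈ →
      let e = ∈⟨⟩⁻ (edge? i) j∈ in ∈N∩⁺ (edge⇒adj e) (edge⇒∈ (edge-sym e)))
      where open Subgraph C

    -- The subgraph induced by `V ∪ W` contains the core and has minimum degree at least `k`, so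
    -- maximality applies. Counting in `V ∪ W` covers both a single vertex attached to the core and
    -- a set that has its degrees within itself.
    core-absorbs : ∀ W → (∀ {i} → i ∈ W → k ℕ.≤ ∣ N i ∩ (V ∪ W) ∣) → W ⊆ˢ V
    core-absorbs W W-deg i∈W =
      proj₁ (proj₂ C-core H H-deg ((λ i∈V → p⊆p∪q W i∈V) , C⊑H)) (q⊆p∪q V W i∈W)
      where
      H : Subgraph G
      H = G [ V ∪ W ]
      C⊑H : ∀ {i j} → Subgraph.Edge C i j → Subgraph.Edge H i j
      C⊑H e = (p⊆p∪q W (edge⇒∈ e) , p⊆p∪q W (edge⇒∈ (edge-sym e))) , edge⇒adj e
        where open Subgraph C
      N∩⊆ : ∀ {i} → i ∈ V ∪ W → N i ∩ (V ∪ W) ⊆ˢ ⟨ Subgraph.edge? H i ⟩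
      N∩⊆ {i} i∈ j∈ = let i~j , j∈VW = ∈N∩⁻ j∈ in ∈⟨⟩⁺ (Subgraph.edge? H i) ((i∈ , j∈VW) , i~j)
      H-deg : MinDegree≥ k H
      H-deg {i} i∈ with x∈p∪q⁻ V W i∈
      ... | inj₁ i∈V = ℕ.≤-trans (proj₁ C-core i∈V) (p⊆q⇒∣p∣≤∣q∣ λ j∈ →
        ∈⟨⟩⁺ (Subgraph.edge? H i) (C⊑H (∈⟨⟩⁻ (Subgraph.edge? C i) j∈)))
      ... | inj₂ i∈W′ = ℕ.≤-trans (W-deg i∈W′) (p⊆q⇒∣p∣≤∣q∣ (N∩⊆ i∈))

    core-outside : ∀ {i} → i ∉ V → ∣ N i ∩ V ∣ ℕ.< k
    core-outside {i} i∉V = ℕ.≰⇒> λ k≤ → i∉V (core-absorbs ⁅ i ⁆ (λ j∈ → deg k≤ (x∈⁅y⁆⇒x≡y i j∈)) (x∈⁅x⁆ i))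
      where
      deg : k ℕ.≤ ∣ N i ∩ V ∣ → ∀ {j} → j ≡ i → k ℕ.≤ ∣ N j ∩ (V ∪ ⁅ i ⁆) ∣
      deg k≤ ≡.refl = ℕ.≤-trans k≤ (p⊆q⇒∣p∣≤∣q∣ λ j∈ →
        let i~j , j∈V = ∈N∩⁻ j∈ in ∈N∩⁺ i~j (p⊆p∪q ⁅ i ⁆ j∈V))

    whole-core : Subgraph.Connected (G [ V ]) → CoreComponent k V
    whole-core connected = record { degree = core-degree ; sparse = core-outside ; connected = connected }

    -- `U` consists of the vertices reachable from `v` inside `V`. Reachability is decided by
    -- excluded middle for each vertex, hence the double negation.
    component : 1 ℕ.≤ k → ∀ {v} → v ∈ V → ¬ ¬ (∃[ U ] Nonempty U × CoreComponent k U)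
    component 1≤k {v} v∈V = do
      reachable? ← finite-choice λ j → ¬¬-excluded-middle {A = Star (Subgraph.Edge (G [ V ])) v j}
      return (from reachable?)
      where
      open DoubleNegation
      Path : Fin n → Fin n → Set
      Path = Star (Subgraph.Edge (G [ V ]))
      from : (∀ j → Dec (Path v j)) → ∃[ U ] Nonempty U × CoreComponent k U
      from reachable? = U , (v , ∈⟨⟩⁺ reachable? ε) , record
        { degree = λ i∈U → ℕ.≤-trans (core-degree (U⊆V i∈U)) (p⊆q⇒∣p∣≤∣q∣ λ j∈ →
            let i~j , j∈V = ∈N∩⁻ j∈ in ∈N∩⁺ i~j (closed i∈U ((U⊆V i∈U , j∈V) , i~j)))
        ; sparse = sparse
        ; connected = λ i∈U j∈U → reverse (Subgraph.edge-sym (G [ U ])) (lift v∈U (∈⟨⟩⁻ reachable? i∈U))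
                                  ◅◅ lift v∈U (∈⟨⟩⁻ reachable? j∈U)
        }
        where
        U : Subset n
        U = ⟨ reachable? ⟩
        v∈U : v ∈ U
        v∈U = ∈⟨⟩⁺ reachable? ε
        path-end : ∀ {i j} → i ∈ V → Path i j → j ∈ V
        path-end i∈V ε                    = i∈V
        path-end i∈V (((_ , j∈V) , _) ◅ p) = path-end j∈V p
        U⊆V : U ⊆ˢ V
        U⊆V i∈U = path-end v∈V (∈⟨⟩⁻ reachable? i∈U)
        closed : ∀ {i j} → i ∈ U → Subgraph.Edge (G [ V ]) i j → j ∈ U
        closed i∈U e = ∈⟨⟩⁺ reachable? (∈⟨⟩⁻ reachable? i∈U ◅◅ (e ◅ ε))
        lift : ∀ {i j} → i ∈ U → Path i j → Star (Subgraph.Edge (G [ U ])) i j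
        lift i∈U ε       = ε
        lift i∈U (e ◅ p) = ((i∈U , closed i∈U e) , proj₂ e) ◅ lift (closed i∈U e) p
        sparse : ∀ {i} → i ∉ U → ∣ N i ∩ U ∣ ℕ.< k
        sparse {i} i∉U with i ∈? V
        ... | no i∉V  = ℕ.≤-<-trans (p⊆q⇒∣p∣≤∣q∣ λ j∈ →
          let i~j , j∈U = ∈N∩⁻ j∈ in ∈N∩⁺ i~j (U⊆V j∈U)) (core-outside i∉V)
        -- A neighbour in `U` would make `i` reachable, so `i` has none, and `0 < k`.
        ... | yes i∈V = ℕ.≰⇒> λ k≤ → isolated (enumerate 1 (ℕ.≤-trans 1≤k k≤))
          where
          isolated : ¬ (∃[ is ] Unique {n = 1} is × All (_∈ N i ∩ U) is)
          isolated (_ ∷ [] , _ , j∈ ∷ []) =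
            let i~j , j∈U = ∈N∩⁻ j∈ in i∉U (closed j∈U ((U⊆V j∈U , i∈V) , adj-sym i~j))

-- Order properties of nonnegative real tensors and their transfer to complex ones.

module RealTensors {c ℓ₁ ℓ₂} (R : RealField c ℓ₁ ℓ₂) where
  open OrderedField R
  open Semiring semiring using (rawSemiring)
  open RawSemiringDefs rawSemiring using (sum; product)
  private module T = Tensors R

  sumIndices : ∀ {m n} → (Vec (Fin n) m → Carrier) → Carrier
  sumIndices {zero}  f = f []
  sumIndices {suc m} f = sum λ i → sumIndices λ is → f (i ∷ is)

  monomial : ∀ {m n} → Vector Carrier n → Vec (Fin n) m → Carrier
  monomial x is = product λ p → x (Vec.lookup is p)

  apply : ∀ {m n} → (Vec (Fin n) (suc m) → Carrier) → Vector Carrier n → Vector Carrier n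
  apply A x i = sumIndices λ is → A (i ∷ is) * monomial x is

  sum-mono-≤ : ∀ {n} {f g : Vector Carrier n} → (∀ i → f i ≤ g i) → sum f ≤ sum g
  sum-mono-≤ {zero}  f≤g = ≤-refl
  sum-mono-≤ {suc n} f≤g = +-mono-≤ (f≤g zero) (sum-mono-≤ (f≤g ∘ suc))

  sum-mono-< : ∀ {n} {f g : Vector Carrier n} i → (∀ i → f i ≤ g i) → f i < g i → sum f < sum g
  sum-mono-< zero    f≤g fi<gi = +-mono-<-≤ fi<gi (sum-mono-≤ (f≤g ∘ suc))
  sum-mono-< (suc i) f≤g fi<gi = +-mono-≤-< (f≤g zero) (sum-mono-< i (f≤g ∘ suc) fi<gi)

  sumIndices-mono-≤ : ∀ {m n} {f g : Vec (Fin n) m → Carrier} →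
                      (∀ is → f is ≤ g is) → sumIndices f ≤ sumIndices g
  sumIndices-mono-≤ {zero}  f≤g = f≤g []
  sumIndices-mono-≤ {suc m} f≤g = sum-mono-≤ λ i → sumIndices-mono-≤ λ is → f≤g (i ∷ is)

  sumIndices-mono-< : ∀ {m n} {f g : Vec (Fin n) m → Carrier} is →
                      (∀ is → f is ≤ g is) → f is < g is → sumIndices f < sumIndices g
  sumIndices-mono-< []       f≤g f<g = f<g
  sumIndices-mono-< (i ∷ is) f≤g f<g = sum-mono-< i
    (λ j → sumIndices-mono-≤ λ js → f≤g (j ∷ js)) (sumIndices-mono-< is (λ js → f≤g (i ∷ js)) f<g)

  sumIndices-cong : ∀ {m n} {f g : Vec (Fin n) m → Carrier} →
                    (∀ is → f is ≈ g is) → sumIndices f ≈ sumIndices g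
  sumIndices-cong f≈g = ≤-antisym (sumIndices-mono-≤ λ is → ≤-reflexive (f≈g is))
                                  (sumIndices-mono-≤ λ is → ≤-reflexive (sym (f≈g is)))

  sum-* : ∀ {n} t (f : Vector Carrier n) → sum (λ i → t * f i) ≈ t * sum f
  sum-* {zero}  t f = sym (zeroʳ t)
  sum-* {suc n} t f = trans (+-congˡ (sum-* t (f ∘ suc))) (sym (distribˡ t (f zero) (sum (f ∘ suc))))

  sumIndices-* : ∀ {m n} t (f : Vec (Fin n) m → Carrier) →
                 sumIndices (λ is → t * f is) ≈ t * sumIndices f
  sumIndices-* {zero}  t f = refl
  sumIndices-* {suc m} t f = trans
    (≤-antisym (sum-mono-≤ λ i → ≤-reflexive (sumIndices-* t (λ is → f (i ∷ is))))
               (sum-mono-≤ λ i → ≤-reflexive (sym (sumIndices-* t (λ is → f (i ∷ is))))))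
    (sum-* t (λ i → sumIndices λ is → f (i ∷ is)))

  sum-zero : ∀ {n} → sum {n} (λ _ → 0#) ≈ 0#
  sum-zero {zero}  = refl
  sum-zero {suc n} = trans (+-identityˡ _) (sum-zero {n})

  sumIndices-zero : ∀ {m n} {f : Vec (Fin n) m → Carrier} → (∀ is → f is ≈ 0#) → sumIndices f ≈ 0#
  sumIndices-zero {m} {n} {f} f≈0 = begin-equality
    sumIndices f                  ≈⟨ sumIndices-cong (λ is → trans (f≈0 is) (sym (zeroˡ 1#))) ⟩
    sumIndices {m} {n} (λ is → 0# * 1#)   ≈⟨ sumIndices-* {m} {n} 0# (λ _ → 1#) ⟩
    0# * sumIndices {m} {n} (λ _ → 1#)    ≈⟨ zeroˡ _ ⟩
    0#                            ∎
    where open ≤-Reasoning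

  sum-nonNeg : ∀ {n} {f : Vector Carrier n} → (∀ i → 0# ≤ f i) → 0# ≤ sum f
  sum-nonNeg {n} 0≤f = ≤-respˡ-≈ (sum-zero {n}) (sum-mono-≤ 0≤f)

  sumIndices-nonNeg : ∀ {m n} {f : Vec (Fin n) m → Carrier} → (∀ is → 0# ≤ f is) → 0# ≤ sumIndices f
  sumIndices-nonNeg {m} {n} 0≤f = ≤-respˡ-≈ (sumIndices-zero {m} {n} λ _ → refl) (sumIndices-mono-≤ 0≤f)

  term≤sum : ∀ {n} {f : Vector Carrier n} → (∀ i → 0# ≤ f i) → ∀ i → f i ≤ sum f
  term≤sum {f = f} 0≤f zero    = ≤-respˡ-≈ (+-identityʳ (f zero)) (+-monoʳ-≤ (f zero) (sum-nonNeg (0≤f ∘ suc)))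
  term≤sum {f = f} 0≤f (suc i) = ≤-respˡ-≈ (+-identityˡ (f (suc i))) (+-mono-≤ (0≤f zero) (term≤sum (0≤f ∘ suc) i))

  term≤sumIndices : ∀ {m n} {f : Vec (Fin n) m → Carrier} → (∀ is → 0# ≤ f is) → ∀ is → f is ≤ sumIndices f
  term≤sumIndices 0≤f []       = ≤-refl
  term≤sumIndices 0≤f (i ∷ is) = ≤-trans (term≤sumIndices (λ js → 0≤f (i ∷ js)) is)
    (term≤sum (λ j → sumIndices-nonNeg λ js → 0≤f (j ∷ js)) i)

  monomial-nonNeg : ∀ {m n} {x : Vector Carrier n} → (∀ i → 0# ≤ x i) → (is : Vec (Fin n) m) → 0# ≤ monomial x is
  monomial-nonNeg 0≤x []       = 0≤1
  monomial-nonNeg 0≤x (i ∷ is) = *-nonNeg (0≤x i) (monomial-nonNeg 0≤x is)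

  monomial-mono-≤ : ∀ {m n} {x y : Vector Carrier n} → (∀ i → 0# ≤ x i) → (∀ i → x i ≤ y i) →
                    (is : Vec (Fin n) m) → monomial x is ≤ monomial y is
  monomial-mono-≤ 0≤x x≤y []       = ≤-refl
  monomial-mono-≤ 0≤x x≤y (i ∷ is) = *-mono-≤ (≤-trans (0≤x i) (x≤y i)) (monomial-nonNeg 0≤x is)
    (x≤y i) (monomial-mono-≤ 0≤x x≤y is)

  monomial-pos : ∀ {m n} {x : Vector Carrier n} {is : Vec (Fin n) m} →
                 All (λ i → 0# < x i) is → 0# < monomial x is
  monomial-pos []           = 0<1
  monomial-pos (xi>0 ∷ x>0) = *-pos xi>0 (monomial-pos x>0)

  monomial≥1 : ∀ {m n} {x : Vector Carrier n} {is : Vec (Fin n) m} →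
               All (λ i → 1# ≤ x i) is → 1# ≤ monomial x is
  monomial≥1 []           = ≤-refl
  monomial≥1 (xi≥1 ∷ x≥1) = ≤-respˡ-≈ (*-identityˡ 1#) (*-mono-≤ (≤-trans 0≤1 xi≥1) 0≤1 xi≥1 (monomial≥1 x≥1))

  monomial-homo : ∀ {m n} t (x : Vector Carrier n) (is : Vec (Fin n) m) →
                  monomial (λ i → t * x i) is ≈ t ^ m * monomial x is
  monomial-homo t x []       = sym (*-identityˡ 1#)
  monomial-homo {suc m} t x (i ∷ is) =
    trans (*-congˡ (monomial-homo t x is)) (interchange t (x i) (t ^ m) (monomial x is))

  monomial-cong : ∀ {m n} {x y : Vector Carrier n} → (∀ i → x i ≈ y i) →
                  (is : Vec (Fin n) m) → monomial x is ≈ monomial y is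
  monomial-cong x≈y []       = refl
  monomial-cong x≈y (i ∷ is) = *-cong (x≈y i) (monomial-cong x≈y is)

  monomial-zero : ∀ {m n p} {P : Fin n → Set p} (P? : ∀ i → Dec (P i)) {x : Vector Carrier n} →
                  (∀ {i} → ¬ P i → x i ≈ 0#) → {is : Vec (Fin n) m} → ¬ All P is → monomial x is ≈ 0#
  monomial-zero P? x≈0 {[]}     ¬all = contradiction [] ¬all
  monomial-zero P? {x} x≈0 {i ∷ is} ¬all with P? i
  ... | yes Pi = trans (*-congˡ (monomial-zero P? x≈0 (¬all ∘ (Pi ∷_)))) (zeroʳ (x i))
  ... | no ¬Pi = trans (*-congʳ (x≈0 ¬Pi)) (zeroˡ (monomial x is))

  module _ {m n} {A : Vec (Fin n) (suc m) → Carrier} (A≥0 : ∀ is → 0# ≤ A is) where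

    apply-nonNeg : ∀ {x} → (∀ i → 0# ≤ x i) → ∀ i → 0# ≤ apply A x i
    apply-nonNeg 0≤x i = sumIndices-nonNeg λ is → *-nonNeg (A≥0 (i ∷ is)) (monomial-nonNeg 0≤x is)

    apply-mono-≤ : ∀ {x y} → (∀ i → 0# ≤ x i) → (∀ i → x i ≤ y i) → ∀ i → apply A x i ≤ apply A y i
    apply-mono-≤ 0≤x x≤y i = sumIndices-mono-≤ λ is → *-monoʳ-≤ (A≥0 (i ∷ is)) (monomial-mono-≤ 0≤x x≤y is)

    apply-mono-< : ∀ {x y i} is → (∀ i → 0# ≤ x i) → (∀ i → x i ≤ y i) →
                   0# < A (i ∷ is) → monomial x is < monomial y is → apply A x i < apply A y i
    apply-mono-< {i = i} is 0≤x x≤y 0<A lt = sumIndices-mono-< is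
      (λ js → *-monoʳ-≤ (A≥0 (i ∷ js)) (monomial-mono-≤ 0≤x x≤y js)) (*-monoʳ-< 0<A lt)

    term≤apply : ∀ {x} i is → (∀ i → 0# ≤ x i) → A (i ∷ is) * monomial x is ≤ apply A x i
    term≤apply i is 0≤x = term≤sumIndices (λ js → *-nonNeg (A≥0 (i ∷ js)) (monomial-nonNeg 0≤x js)) is

  apply-cong : ∀ {m n} (A : Vec (Fin n) (suc m) → Carrier) {x y} → (∀ i → x i ≈ y i) →
               ∀ i → apply A x i ≈ apply A y i
  apply-cong {m} {n} A x≈y i = sumIndices-cong {m} {n} λ is → *-congˡ (monomial-cong x≈y is)

  apply-homo : ∀ {m n} (A : Vec (Fin n) (suc m) → Carrier) t x i →
               apply A (λ j → t * x j) i ≈ t ^ m * apply A x i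
  apply-homo {m} {n} A t x i = begin-equality
    sumIndices (λ is → A (i ∷ is) * monomial (λ j → t * x j) is)
      ≈⟨ sumIndices-cong {m} {n} (λ is → trans (*-congˡ (monomial-homo t x is))
           (x∙yz≈y∙xz (A (i ∷ is)) (t ^ m) (monomial x is))) ⟩
    sumIndices (λ is → t ^ m * (A (i ∷ is) * monomial x is))
      ≈⟨ sumIndices-* (t ^ m) (λ is → A (i ∷ is) * monomial x is) ⟩
    t ^ m * apply A x i  ∎
    where open ≤-Reasoning

  open T using (ℂ; real) public

  real-+ : ∀ {z w a b} → z T.≈ real a → w T.≈ real b → z T.+ w T.≈ real (a + b)
  real-+ (z≈a , z≈0) (w≈b , w≈0) = +-cong z≈a w≈b , trans (+-cong z≈0 w≈0) (+-identityˡ 0#)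

  real-* : ∀ {z w a b} → z T.≈ real a → w T.≈ real b → z T.* w T.≈ real (a * b)
  real-* {a = a} {b} (z≈a , z≈0) (w≈b , w≈0) = re , im
    where
    re : _
    re = trans (+-cong (*-cong z≈a w≈b) (-‿cong (trans (*-cong z≈0 w≈0) (zeroˡ 0#))))
           (trans (+-congˡ -0#≈0#) (+-identityʳ (a * b)))
    im : _
    im = trans (+-cong (trans (*-congˡ w≈0) (zeroʳ _)) (trans (*-congʳ z≈0) (zeroˡ _))) (+-identityˡ 0#)

  real-^ : ∀ {z a} → z T.≈ real a → ∀ m → z T.^ m T.≈ real (a ^ m)
  real-^ z≈a zero    = refl , refl
  real-^ z≈a (suc m) = real-* z≈a (real-^ z≈a m)

  real-sum : ∀ {n} {f : Vector ℂ n} {g} → (∀ i → f i T.≈ real (g i)) → T.sum f T.≈ real (sum g)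
  real-sum {zero}  f≈g = refl , refl
  real-sum {suc n} f≈g = real-+ (f≈g zero) (real-sum (f≈g ∘ suc))

  real-product : ∀ {n} {f : Vector ℂ n} {g} → (∀ i → f i T.≈ real (g i)) → T.product f T.≈ real (product g)
  real-product {zero}  f≈g = refl , refl
  real-product {suc n} f≈g = real-* (f≈g zero) (real-product (f≈g ∘ suc))

  real-sumIndices : ∀ {m n} {f : Vec (Fin n) m → ℂ} {g} → (∀ is → f is T.≈ real (g is)) →
                    T.sumIndices f T.≈ real (sumIndices g)
  real-sumIndices {zero}  f≈g = f≈g []
  real-sumIndices {suc m} f≈g = real-sum λ i → real-sumIndices λ is → f≈g (i ∷ is)

  real-apply : ∀ {m n} {A : T.Tensor (suc m) n} {B x y} → (∀ is → A is T.≈ real (B is)) →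
               (∀ i → x i T.≈ real (y i)) → ∀ i → T.apply A x i T.≈ real (apply B y i)
  real-apply A≈B x≈y i = real-sumIndices λ is →
    real-* (A≈B (i ∷ is)) (real-product λ p → x≈y (Vec.lookup is p))

  module _ {n} (k : ℕ) (G : Graph n) where
    open Graph G using (Adj; adj?)

    abstract
      weight : Carrier
      weight = RawMonoidDefs._×_ +-rawMonoid (k ℕ.!) 1# ⁻¹

      weight-pos : 0# < weight
      weight-pos = ⁻¹-pos (multiple-pos (k ℕ.!) (ℕ.n≢0⇒n>0 (ℕ.≢-nonZero⁻¹ (k ℕ.!) {{k ℕ.!≢0}})))
        where
        open RawMonoidDefs +-rawMonoid using () renaming (_×_ to _×′_)
        multiple-nonNeg : ∀ m → 0# ≤ m ×′ 1#
        multiple-nonNeg zero    = ≤-refl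
        multiple-nonNeg (suc m) = ≤-respˡ-≈ (+-identityˡ 0#) (+-mono-≤ 0≤1 (multiple-nonNeg m))
        multiple-pos : ∀ m → 0 ℕ.< m → 0# < m ×′ 1#
        multiple-pos (suc m) _ = <-respˡ-≈ (+-identityˡ 0#) (+-mono-<-≤ 0<1 (multiple-nonNeg m))

      entry : Vec (Fin n) (suc k) → Carrier
      entry is = proj₁ (T.adjacencyTensor k G is)

      star? : ∀ i (is : Vec (Fin n) k) → Dec (Unique (i ∷ is) × All (Adj i) is)
      star? i is = allPairs? (λ j l → ¬? (j Fin.≟ l)) (i ∷ is) ×-dec all? (adj? i) is

      -- The body of `adjacencyTensor` with its test made a variable, so that facts about entries
      -- become case splits on a Boolean.
      branch : Bool → ℂ
      branch b = if b then real weight else T.0#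

      adjacencyTensor-real : ∀ is → T.adjacencyTensor k G is T.≈ real (entry is)
      adjacencyTensor-real (i ∷ is) = refl , im (does (star? i is))
        where
        im : ∀ b → proj₂ (branch b) ≈ 0#
        im true  = refl
        im false = refl

      entry-nonNeg : ∀ is → 0# ≤ entry is
      entry-nonNeg (i ∷ is) = re (does (star? i is))
        where
        re : ∀ b → 0# ≤ proj₁ (branch b)
        re true  = <⇒≤ weight-pos
        re false = ≤-refl

      entry-star : ∀ {i is} → Unique (i ∷ is) → All (Adj i) is → entry (i ∷ is) ≡ weight
      entry-star {i} {is} uniq adj = ≡.cong (proj₁ ∘ branch) (dec-true (star? i is) (uniq , adj))

      entry-zero : ∀ {i is} → ¬ (Unique (i ∷ is) × All (Adj i) is) → entry (i ∷ is) ≡ 0#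
      entry-zero {i} {is} ¬star = ≡.cong (proj₁ ∘ branch) (dec-false (star? i is) ¬star)

-- The adjacency tensor on a component of the core.

module CoreTensor {c ℓ₁ ℓ₂} (R : RealField c ℓ₁ ℓ₂) {n} (G : Graph n) (m : ℕ) where
  open OrderedField R
  open RealTensors R
  open PerronFrobenius R
  open Neighbourhoods G
  open SubsetEnumeration
  open DoubleNegation
  open Graph G using (Adj; irrefl)
  private
    module T = Tensors R
    k = suc m

  F : Vector Carrier n → Vector Carrier n
  F = apply (entry k G)

  -- Every term is zero: an index outside `W` kills the monomial, and `k` indices inside `W` cannot
  -- all be distinct neighbours of `i`, so the entry is zero.
  F-vanishes : ∀ {W x i} → ∣ N i ∩ W ∣ ℕ.< k → (∀ {j} → j ∉ W → x j ≈ 0#) → F x i ≈ 0#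
  F-vanishes {W} {x} {i} few x≈0 = sumIndices-zero λ is → term is (all? (_∈? W) is)
    where
    term : ∀ (is : Vec (Fin n) k) → Dec (All (_∈ W) is) → entry k G (i ∷ is) * monomial x is ≈ 0#
    term is (no ¬all)  = trans (*-congˡ (monomial-zero (_∈? W) x≈0 ¬all)) (zeroʳ _)
    term is (yes is∈W) = trans (*-congʳ (reflexive (entry-zero k G λ { (_ ∷ uniq , adj) →
      ℕ.<⇒≱ few (unique⇒≤∣p∣ uniq (All.map (λ (i~j , j∈W) → ∈N∩⁺ i~j j∈W) (All.zip (adj , is∈W)))) })))
      (zeroˡ _)

  module _ (U : Subset n) where

    mask : Vector Carrier n → Vector Carrier n
    mask x j = if does (j ∈? U) then x j else 0#

    mask-∈ : ∀ x {j} → j ∈ U → mask x j ≡ x j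
    mask-∈ x {j} j∈U = ≡.cong (if_then x j else 0#) (dec-true (j ∈? U) j∈U)

    mask-∉ : ∀ x {j} → j ∉ U → mask x j ≡ 0#
    mask-∉ x {j} j∉U = ≡.cong (if_then x j else 0#) (dec-false (j ∈? U) j∉U)

    mask-nonNeg : ∀ {x} → (∀ {j} → j ∈ U → 0# ≤ x j) → ∀ j → 0# ≤ mask x j
    mask-nonNeg {x} 0≤x j with j ∈? U
    ... | yes j∈U = 0≤x j∈U
    ... | no _    = ≤-refl

    mask-mono : ∀ {x y} → (∀ {j} → j ∈ U → x j ≤ y j) → ∀ j → mask x j ≤ mask y j
    mask-mono x≤y j with j ∈? U
    ... | yes j∈U = x≤y j∈U
    ... | no _    = ≤-refl

    mask-* : ∀ t x j → mask (λ i → t * x i) j ≈ t * mask x j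
    mask-* t x j with j ∈? U
    ... | yes _ = refl
    ... | no _  = sym (zeroʳ t)

    module _ (comp : CoreComponent k U) where
      open CoreComponent comp
      open Subgraph (G [ U ]) using (Edge; edge⇒∈; edge-sym)

      -- Since `i` has at least `k` neighbours in `U`, the neighbour `j` can be completed by
      -- `m = k - 1` others. This one term of the sum yields both `map-strict` and `map-bound`.
      star : ∀ {i j} → Edge i j →
             ∃[ is ] 0# < entry k G (i ∷ j ∷ is) × entry k G (i ∷ j ∷ is) ≡ weight k G × All (_∈ U) is
      star {i} {j} ((i∈U , j∈U) , i~j) = is , ≡.subst (0# <_) (≡.sym eq) (weight-pos k G) , eq , is∈U
        where
        found : ∃[ is ] Unique {n = k} (j ∷ is) × All (_∈ N i ∩ U) (j ∷ is)
        found = enumerate-from m (degree i∈U) (∈N∩⁺ i~j j∈U)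
        is : Vec (Fin n) m
        is = proj₁ found
        all∈ : All (_∈ N i ∩ U) (j ∷ is)
        all∈ = proj₂ (proj₂ found)
        is∈U : All (_∈ U) is
        is∈U = All.map (proj₂ ∘ ∈N∩⁻) (All.tail all∈)
        adj : All (Adj i) (j ∷ is)
        adj = All.map (proj₁ ∘ ∈N∩⁻) all∈
        eq : entry k G (i ∷ j ∷ is) ≡ weight k G
        eq = entry-star k G (All.map (λ { i~i ≡.refl → irrefl i~i }) adj ∷ proj₁ (proj₂ found)) adj

      irreducibleMap : IrreducibleMap U k
      irreducibleMap = record
        { Edge       = Edge
        ; source     = edge⇒∈
        ; target     = edge⇒∈ ∘ edge-sym
        ; neighbour  = neighbour
        ; connected  = connected
        ; map        = F ∘ mask
        ; map-nonNeg = λ 0≤x → apply-nonNeg (entry-nonNeg k G) (mask-nonNeg 0≤x) _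
        ; map-mono   = λ 0≤x x≤y → apply-mono-≤ (entry-nonNeg k G) (mask-nonNeg 0≤x) (mask-mono x≤y) _
        ; map-homo   = map-homo
        ; map-strict = map-strict
        ; coeff      = weight k G
        ; coeff-pos  = weight-pos k G
        ; map-bound  = map-bound
        }
        where
        open ≤-Reasoning
        neighbour : ∀ {i} → i ∈ U → ∃[ j ] Edge i j
        neighbour i∈U with enumerate 1 (ℕ.≤-trans (ℕ.s≤s ℕ.z≤n) (degree i∈U))
        ... | j ∷ [] , _ , j∈ ∷ [] = let i~j , j∈U = ∈N∩⁻ j∈ in j , (i∈U , j∈U) , i~j
        map-homo : ∀ t x i → F (mask (λ j → t * x j)) i ≈ t ^ k * F (mask x) i
        map-homo t x i = trans
          (apply-cong (entry k G) (mask-* t x) i)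
          (apply-homo (entry k G) t (mask x) i)
        map-strict : ∀ {x y i j} → Edge i j → (∀ {l} → l ∈ U → 0# ≤ x l) →
                     (∀ {l} → l ∈ U → 0# < y l) → (∀ {l} → l ∈ U → x l ≤ y l) →
                     x j < y j → F (mask x) i < F (mask y) i
        -- Only the factor at `j` grows strictly, so the remaining factors, taken at `y`, must be
        -- positive.
        map-strict {x} {y} {i} {j} e 0≤x 0<y x≤y xj<yj =
          let is , entry>0 , _ , is∈U = star e
              j∈U = edge⇒∈ (edge-sym e)
          in apply-mono-< (entry-nonNeg k G) (j ∷ is) (mask-nonNeg 0≤x) (mask-mono x≤y) entry>0
            (begin-strict
              mask x j * monomial (mask x) is
                ≤⟨ *-monoʳ-≤ (mask-nonNeg 0≤x j) (monomial-mono-≤ (mask-nonNeg 0≤x) (mask-mono x≤y) is) ⟩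
              mask x j * monomial (mask y) is
                <⟨ *-monoˡ-< (monomial-pos (All.map (λ l∈U → <-respʳ-≈ (sym (reflexive (mask-∈ y l∈U))) (0<y l∈U)) is∈U))
                     (<-respˡ-≈ (sym (reflexive (mask-∈ x j∈U))) (<-respʳ-≈ (sym (reflexive (mask-∈ y j∈U))) xj<yj)) ⟩
              mask y j * monomial (mask y) is  ∎)
        map-bound : ∀ {x i j} → Edge i j → (∀ {l} → l ∈ U → 1# ≤ x l) → weight k G * x j ≤ F (mask x) i
        map-bound {x} {i} {j} e 1≤x =
          let is , _ , entry≡ , is∈U = star e
              0≤x = mask-nonNeg (λ l∈U → ≤-trans 0≤1 (1≤x l∈U))
          in begin
            weight k G * x j  ≡⟨ ≡.cong₂ _*_ entry≡ (mask-∈ x (edge⇒∈ (edge-sym e))) ⟨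
            entry k G (i ∷ j ∷ is) * mask x j  ≈⟨ *-congˡ (*-identityʳ (mask x j)) ⟨
            entry k G (i ∷ j ∷ is) * (mask x j * 1#)
              ≤⟨ *-monoʳ-≤ (entry-nonNeg k G (i ∷ j ∷ is)) (*-monoʳ-≤ (0≤x j)
                   (monomial≥1 (All.map (λ l∈U → ≤-respʳ-≈ (sym (reflexive (mask-∈ x l∈U))) (1≤x l∈U)) is∈U))) ⟩
            entry k G (i ∷ j ∷ is) * monomial (mask x) (j ∷ is)
              ≤⟨ term≤apply (entry-nonNeg k G) i (j ∷ is) 0≤x ⟩
            F (mask x) i  ∎

      -- Outside U both sides vanish, because no vertex there has k neighbours in U.
      component-eigenvalue : ∀ {μ y} → Nonempty U → (∀ i → i ∈ U → 0# < y i × F (mask y) i ≈ μ * y i ^ k) →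
                             T.IsEigenvalue (T.adjacencyTensor k G) (real μ)
      component-eigenvalue {μ} {y} (u , u∈U) eigen =
        real ∘ mask y
        , (λ x≈0 → >⇒≉ (proj₁ (eigen u u∈U)) (trans (reflexive (≡.sym (mask-∈ y u∈U))) (proj₁ (x≈0 u))))
        , λ i → let p = real-apply (adjacencyTensor-real k G) (λ j → refl {mask y j} , refl {0#}) i
                    q = real-* {a = μ} (refl {μ} , refl {0#}) (real-^ (refl {mask y i} , refl {0#}) k)
                in trans (proj₁ p) (trans (eigen′ i) (sym (proj₁ q))) , trans (proj₂ p) (sym (proj₂ q))
        where
        eigen′ : ∀ i → F (mask y) i ≈ μ * mask y i ^ k
        eigen′ i with i ∈? U
        ... | yes i∈U = proj₂ (eigen i i∈U)
        ... | no i∉U  = trans (F-vanishes (sparse i∉U) (λ j∉U → reflexive (mask-∉ y j∉U)))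
                          -- Since `k = suc m`, the power `0# ^ k` has a factor `0#`.
                          (sym (trans (*-congˡ (zeroˡ (0# ^ m))) (zeroʳ μ)))

      -- The positive eigenvalue `μ` is its own modulus, so the spectral radius bounds it.
      component-eigenvector : ∀ {ρ} → T.IsSpectralRadius (T.adjacencyTensor k G) ρ → Nonempty U →
        ¬ ¬ (∃[ μ ] ∃[ y ] 0# < μ × μ ≤ ρ × (∀ i → i ∈ U → 0# < y i × F (mask y) i ≈ μ * y i ^ k))
      component-eigenvector (_ , largest) nonempty = do
        μ , y , 0<μ , eigen ← Perron.eigenvector irreducibleMap nonempty
        return (μ , y , 0<μ , largest (real μ) μ (component-eigenvalue nonempty eigen)
          (<⇒≤ 0<μ , sym (trans (+-congˡ (zeroˡ 0#)) (+-identityʳ (μ * μ)))) , eigen)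

-- The support of a Perron eigenvector.

module PerronSupport {c ℓ₁ ℓ₂} (R : RealField c ℓ₁ ℓ₂) {n} (G : Graph n) (m : ℕ)
         (C : Subgraph G) (C-core : IsCore (suc m) C) (x : Vector (Tensors.ℂ R) n)
         (perron : Tensors.IsPerronEigenvector R (Tensors.adjacencyTensor R (suc m) G) x) where
  open OrderedField R
  open RealTensors R
  open PerronFrobenius R
  open Neighbourhoods G
  open CoreTensor R G m
  open SubsetEnumeration
  open DoubleNegation
  open Subgraph C using () renaming (verts to V)
  private
    module T = Tensors R
    k = suc m

  ρ : Carrier
  ρ = proj₁ perron

  spectral : T.IsSpectralRadius (T.adjacencyTensor k G) ρ
  spectral = proj₁ (proj₂ perron)

  a : Vector Carrier n
  a i = proj₁ (x i)

  x-real : ∀ i → x i T.≈ real (a i)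
  x-real i = refl , proj₂ (proj₂ (proj₂ (proj₂ perron)) i)

  a≥0 : ∀ i → 0# ≤ a i
  a≥0 i = proj₁ (proj₂ (proj₂ (proj₂ perron)) i)

  a≉0 : ¬ (∀ i → a i ≈ 0#)
  a≉0 a≈0 = proj₁ (proj₁ (proj₂ (proj₂ perron))) λ i → a≈0 i , proj₂ (x-real i)

  a-eigen : ∀ i → F a i ≈ ρ * a i ^ k
  a-eigen i = begin-equality
    F a i                                ≈⟨ proj₁ (real-apply (adjacencyTensor-real k G) x-real i) ⟨
    proj₁ (T.apply (T.adjacencyTensor k G) x i)
                                         ≈⟨ proj₁ (proj₂ (proj₁ (proj₂ (proj₂ perron))) i) ⟩
    proj₁ (real ρ T.* x i T.^ k)         ≈⟨ proj₁ (real-* {a = ρ} (refl {ρ} , refl {0#}) (real-^ (x-real i) k)) ⟩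
    ρ * a i ^ k                          ∎
    where open ≤-Reasoning

  a>0 : ∀ {i} → ¬ a i ≈ 0# → 0# < a i
  a>0 ai≉0 = a≥0 _ , ai≉0 ∘ sym

  W : Subset n
  W = ⟨ (λ i → ¬? (a i ≟ 0#)) ⟩

  ∉W⇒a≈0 : ∀ {i} → i ∉ W → a i ≈ 0#
  ∉W⇒a≈0 {i} i∉W = decidable-stable (a i ≟ 0#) (i∉W ∘ ∈⟨⟩⁺ (λ i → ¬? (a i ≟ 0#)))

  -- With fewer neighbours in the support, `F a i` would vanish, whereas `ρ * a i ^ k` is positive.
  W-degree : 0# < ρ → ∀ {i} → i ∈ W → k ℕ.≤ ∣ N i ∩ W ∣
  W-degree 0<ρ {i} i∈W = ℕ.≮⇒≥ λ few →
    >⇒≉ (*-pos 0<ρ (^-pos (a>0 (∈⟨⟩⁻ (λ i → ¬? (a i ≟ 0#)) i∈W)) k))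
        (trans (sym (a-eigen i)) (F-vanishes few ∉W⇒a≈0))

  W⊆V : 0# < ρ → W ⊆ˢ V
  W⊆V 0<ρ = core-absorbs C C-core W λ i∈W → ℕ.≤-trans (W-degree 0<ρ i∈W)
    (p⊆q⇒∣p∣≤∣q∣ λ j∈ → let i~j , j∈W = ∈N∩⁻ j∈ in ∈N∩⁺ i~j (q⊆p∪q V W j∈W))

  supp⊆W : T.supp x ⊆ (_∈ W)
  supp⊆W xi≉0 = ∈⟨⟩⁺ (λ i → ¬? (a i ≟ 0#)) λ ai≈0 → xi≉0 (ai≈0 , proj₂ (x-real _))

  -- A component of the core is used only for its eigenvalue `μ` with `0 < μ ≤ ρ`, which gives
  -- `ρ > 0`.
  supp⊆V : Nonempty V → T.supp x ⊆ (_∈ V)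
  supp⊆V (v , v∈V) {i} xi≉0 = decidable-stable (i ∈? V) do
    U , nonempty , comp ← component C C-core (ℕ.s≤s ℕ.z≤n) v∈V
    μ , y , 0<μ , μ≤ρ , _ ← component-eigenvector U comp spectral nonempty
    return (W⊆V (<-≤-trans 0<μ μ≤ρ) (supp⊆W xi≉0))

  module _ (nonempty : Nonempty V) (connected : Subgraph.Connected (G [ V ])) where
    open Subgraph (G [ V ]) using (Edge; edge⇒∈; edge-sym)
    open IrreducibleMap (irreducibleMap V (whole-core C C-core connected)) using (map; map-homo; map-strict)

    -- The first inclusion makes `a` vanish outside `V`, so masking does not change it.
    map-a≈Fa : ∀ i → map a i ≈ F a i
    map-a≈Fa = apply-cong (entry k G) λ j → masked j (j ∈? V)
      where
      masked : ∀ j → Dec (j ∈ V) → mask V a j ≈ a j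
      masked j (yes j∈V) = reflexive (mask-∈ V a j∈V)
      masked j (no j∉V)  = trans (reflexive (mask-∉ V a j∉V)) (sym (decidable-stable (a j ≟ 0#)
        λ aj≉0 → j∉V (supp⊆V nonempty (aj≉0 ∘ proj₁))))

    module _ {μ y} (μ≤ρ : μ ≤ ρ) (eigen : ∀ i → i ∈ V → 0# < y i × map y i ≈ μ * y i ^ k)
             {t} (a≤ty : ∀ {j} → j ∈ V → a j ≤ t * y j) where
      open ≤-Reasoning

      t>0 : 0# < t
      t>0 = ≰⇒> λ t≤0 → a≉0 λ i → decidable-stable (a i ≟ 0#) λ ai≉0 →
        let i∈V = supp⊆V nonempty (ai≉0 ∘ proj₁) in
        <⇒≱ (a>0 ai≉0) (begin
          a i      ≤⟨ a≤ty i∈V ⟩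
          t * y i  ≤⟨ *-monoˡ-≤ (<⇒≤ (proj₁ (eigen i i∈V))) t≤0 ⟩
          0# * y i ≈⟨ zeroˡ (y i) ⟩
          0#       ∎)

      ty>0 : ∀ {j} → j ∈ V → 0# < t * y j
      ty>0 {j} j∈V = *-pos t>0 (proj₁ (eigen j j∈V))

      -- If `a j < t * y j`, strict monotonicity gives `map a i < map (t y) i = μ * a i ^ k`, which
      -- is at most `ρ * a i ^ k = map a i`.
      equality-spreads : ∀ {i j} → Edge i j → a i ≈ t * y i → a j ≈ t * y j
      equality-spreads {i} {j} e ai≈ = decidable-stable (a j ≟ t * y j) λ aj≉ → <⇒≱
        (map-strict e (λ _ → a≥0 _) ty>0 a≤ty (a≤ty (edge⇒∈ (edge-sym e)) , aj≉)) (begin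
          map (λ l → t * y l) i   ≈⟨ map-homo t y i ⟩
          t ^ k * map y i         ≈⟨ *-congˡ (proj₂ (eigen i (edge⇒∈ e))) ⟩
          t ^ k * (μ * y i ^ k)   ≈⟨ x∙yz≈y∙xz (t ^ k) μ (y i ^ k) ⟩
          μ * (t ^ k * y i ^ k)   ≈⟨ *-congˡ (^-distrib-* t (y i) k) ⟨
          μ * (t * y i) ^ k       ≈⟨ *-congˡ (^-congˡ k ai≈) ⟨
          μ * a i ^ k             ≤⟨ *-monoˡ-≤ (^-nonNeg (a≥0 i) k) μ≤ρ ⟩
          ρ * a i ^ k             ≈⟨ a-eigen i ⟨
          F a i                   ≈⟨ map-a≈Fa i ⟨
          map a i                 ∎)

      path-equality : ∀ {i j} → Star Edge i j → a i ≈ t * y i → a j ≈ t * y j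
      path-equality ε       eq = eq
      path-equality (e ◅ p) eq = path-equality p (equality-spreads e eq)

    -- With `t` the largest ratio `a / y` on `V`, the equality `a = t * y` holds at a maximiser and
    -- is carried along a path to `i`, where `t * y i` is positive.
    V⊆supp : (_∈ V) ⊆ T.supp x
    V⊆supp {i} i∈V xi≈0 = all-positive (λ ai>0 → >⇒≉ ai>0 (proj₁ xi≈0))
      where
      all-positive : ¬ ¬ 0# < a i
      all-positive = do
        μ , y , 0<μ , μ≤ρ , eigen ← component-eigenvector V (whole-core C C-core connected) spectral nonempty
        let y>0 : ∀ {j} → j ∈ V → 0# < y j
            y>0 j∈V = proj₁ (eigen _ j∈V)
            ratio : Vector Carrier n
            ratio j = y j ⁻¹ * a j
            a≈ : ∀ {j} → j ∈ V → ratio j * y j ≈ a j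
            a≈ {j} j∈V = trans (*-comm (ratio j) (y j)) (⁻¹-cancelʳ (y>0 j∈V) (a j))
        -- The reversed order turns the minimum into a maximum.
        q , q∈V , maximal ← extremum (λ i j → ratio j ≤ ratio i) (λ i j → total (ratio j) (ratio i))
          (λ j≤i l≤j → ≤-trans l≤j j≤i) nonempty
        let a≤ty : ∀ {j} → j ∈ V → a j ≤ ratio q * y j
            a≤ty {j} j∈V = ≤-respˡ-≈ (a≈ j∈V) (*-monoˡ-≤ (<⇒≤ (y>0 j∈V)) (maximal j∈V))
        return (<-respʳ-≈ (sym (path-equality μ≤ρ eigen a≤ty (connected q∈V i∈V) (sym (a≈ q∈V))))
                          (ty>0 μ≤ρ eigen a≤ty i∈V))

open import Data.Nat.Base using (_≤_)

theorem3p2 : ∀ {c ℓ₁ ℓ₂} (R : RealField c ℓ₁ ℓ₂) → let open Tensors R in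
    ∀ (n : ℕ) (G : Graph n) (k : ℕ) → 1 ≤ k →
    ∀ (C : Subgraph G) → IsCore k C → let V = Subgraph.verts C in Nonempty V →
    ∀ (x : Vector ℂ n) → IsPerronEigenvector (adjacencyTensor k G) x →
    (supp x ⊆ (_∈ V)) × (Subgraph.Connected (G [ V ]) → supp x ≐ (_∈ V))
theorem3p2 R n G (suc m) _ C C-core nonempty x perron =
  supp⊆V nonempty , λ connected → supp⊆V nonempty , V⊆supp nonempty connected
  where open PerronSupport R G m C C-core x perron
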